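{- \[ \limsup_{n\to \infty} \frac{\phi(\phi^*(n))}{n}= \limsup_{n\to\infty} \frac{\phi^*(\phi(n))}{n}= \limsup_{n\to\infty} \frac{\phi^*(\phi^*(n))}{n}=1. \]
   Context: $\phi(n)$ is Euler's totient function. $\phi^*$ is the unitary Euler function: the multiplicative function with $\phi^*(1)=1$ and, if $n=p_1^{a_1}\cdots p_r^{a_r}$ is the prime factorization of $n>1$, $\phi^*(n)=(p_1^{a_1}-1)\cdots(p_r^{a_r}-1)$. -}

module Defs where

open import Data.Nat using (ℕ; zero; suc; _+_; _*_; _∸_; _^_; _≤_; _<_; _≟_)
open import Data.Nat.GCD using (gcd)
open import Data.Nat.Divisibility using (_∣_; _∣?_)
open import Data.Nat.Primality using (Prime; prime?)
open import Data.List using (List; filter; length; map; upTo)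
open import Data.Nat.ListAction using (product)
open import Data.Product using (Σ; _×_; ∃-syntax)

range1 : ℕ → List ℕ
range1 n = map suc (upTo n)

φ : ℕ → ℕ
φ n = length (filter (λ k → gcd k n ≟ 1) (range1 n))

-- p-adic valuation of n (n ≥ 1): number of a ∈ [1..n] with p^a ∣ n
-- (the set of such a is downward closed, so this is the largest such a)
val : ℕ → ℕ → ℕ
val p n = length (filter (λ a → (p ^ a) ∣? n) (range1 n))

φ* : ℕ → ℕ
φ* n = product (map (λ p → p ^ val p n ∸ 1)
                    (filter (λ p → p ∣? n) (filter prime? (range1 n))))

-- limsup_{n→∞} f(n)/n = 1, with ε ranging over 1/(k+1):
--  (i) for every ε > 0 there is N with f(n)/n < 1 + ε for all n ≥ N, and
-- (ii) for every ε > 0 and every N there is n ≥ N with f(n)/n > 1 - ε.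
-- Inequalities are cross-multiplied to stay in ℕ (n ≥ 1 throughout).
LimsupRatioIsOne : (ℕ → ℕ) → Set
LimsupRatioIsOne f =
  ((k : ℕ) → ∃[ N ] ((n : ℕ) → N ≤ n → suc k * f n < (suc k + 1) * n))
  × ((k : ℕ) (N : ℕ) → ∃[ n ] (N ≤ n × 1 ≤ n × k * n < suc k * f n))

{-# OPTIONS --safe #-}
module Submission where

-- The upper bounds are trivial. For the lower bounds: an integer m ≤ R ^ B has at most B pairwise coprime
-- factors ≥ R, so if every prime factor (resp. every p ^ val p m with p ∣ m) is ≥ R, then φ m (resp. φ* m)
-- is at least m (1 - B / R).
--
-- For φ ∘ φ* and φ* ∘ φ* take n = 2 ^ p with p prime: φ* n = 2 ^ p - 1 has all its prime factors ≥ p,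
-- and B ≈ p / log p is negligible against R = p.
--
-- For φ* ∘ φ take R = 4 ^ s. Chebyshev's upper bound gives π(R) = o(R), and his lower bound provides
-- T = π(R) + o(R) primes in (R, R²]. Whenever a prime r ≤ R divides p - 1 for some, but too few, of these
-- primes p, discard those p; each r is treated at most once and costs so little that a nonempty set S of
-- primes survives. For n = ∏ S, every r ^ val r (φ n) with r ∣ φ n = ∏ (p - 1) is then ≥ R, while
-- φ n ≤ n ≤ R ^ (2 T) and T = o(R).

open import Defs
open import Data.Fin using (Fin; toℕ; fromℕ<)
open import Data.Fin.Properties using (pigeonhole; toℕ-fromℕ<; toℕ≤pred[n])
open import Data.List using (List; []; _∷_; _++_; filter; length; map; upTo; applyUpTo; take)
open import Data.List.Properties using (map-++; filter-++; length-++; upTo-∷ʳ; map-∘; length-map; length-filter; length-applyUpTo; filter-none; length-take)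
open import Data.List.Membership.Propositional using (_∈_; find)
open import Data.List.Membership.Propositional.Properties
open import Data.List.Relation.Unary.All as All using (All; []; _∷_)
import Data.List.Relation.Unary.All.Properties as All
open import Data.List.Relation.Unary.AllPairs using ([]; _∷_)
open import Data.List.Relation.Unary.Any as Any using (Any; here; there)
open import Data.List.Relation.Unary.Unique.Propositional using (Unique)
import Data.List.Relation.Unary.Unique.Propositional.Properties as Unique
open import Data.Nat
open import Data.Nat.Combinatorics using (_C_; nCn≡1; nCk≡nC[n∸k]; nCk+nC[k+1]≡[n+1]C[k+1]; nCk≡n!/k![n-k]!; k>n⇒nCk≡0; k![n∸k]!∣n!)
open import Data.Nat.Coprimality using (prime⇒coprime; coprime-Bézout)
open import Data.Nat.Divisibility
open import Data.Nat.DivMod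
open import Data.Nat.GCD using (gcd; gcd[m,n]∣m; gcd[m,n]∣n; gcd-greatest; gcd[m,n]≢0; module Bézout)
open import Data.Nat.ListAction using (sum; product)
open import Data.Nat.ListAction.Properties using (∈⇒∣product; product-++; sum-++; product≢0)
open import Data.Nat.Primality
open import Data.Nat.Primality.Factorisation using (factorise)
open import Data.Nat.Properties
open import Data.Nat.Tactic.RingSolver using (solve-∀)
open import Data.Product using (_×_; _,_; proj₁; proj₂; ∃-syntax)
open import Data.Sum using (_⊎_; inj₁; inj₂; [_,_]′)
open import Function using (_∘_; id)
open import Relation.Binary.PropositionalEquality
open import Relation.Nullary using (¬_; Dec; yes; no; contradiction; ¬?)
open import Relation.Unary using (Decidable)

-- Primes, prime powers and divisibility

prime⇒2≤ : ∀ {p} → Prime p → 2 ≤ p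
prime⇒2≤ {p} pp = nonTrivial⇒n>1 p {{prime⇒nonTrivial pp}}

prime∣prime⇒≡ : ∀ {p q} → Prime p → Prime q → p ∣ q → p ≡ q
prime∣prime⇒≡ pp pq p∣q with prime⇒irreducible pq p∣q
... | inj₁ refl = contradiction pp ¬prime[1]
... | inj₂ eq   = eq

prime∣^⇒∣ : ∀ {p} → Prime p → ∀ m k → p ∣ m ^ k → p ∣ m
prime∣^⇒∣ pp m zero    p∣ = contradiction (subst Prime (∣1⇒≡1 p∣) pp) ¬prime[1]
prime∣^⇒∣ pp m (suc k) p∣ = [ id , prime∣^⇒∣ pp m k ]′ (euclidsLemma m (m ^ k) pp p∣)

prime∣product⇒∃ : ∀ {p} → Prime p → ∀ ms → p ∣ product ms → ∃[ m ] (m ∈ ms × p ∣ m)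
prime∣product⇒∃ pp []       p∣ = contradiction (subst Prime (∣1⇒≡1 p∣) pp) ¬prime[1]
prime∣product⇒∃ pp (m ∷ ms) p∣ with euclidsLemma m (product ms) pp p∣
... | inj₁ p∣m = m , here refl , p∣m
... | inj₂ p∣r with prime∣product⇒∃ pp ms p∣r
...   | m′ , m′∈ , p∣m′ = m′ , there m′∈ , p∣m′

^-cancelˡ-∣ : ∀ {p} → Prime p → ∀ k m n → ¬ p ∣ m → p ^ k ∣ m * n → p ^ k ∣ n
^-cancelˡ-∣ pp zero m n p∤m _ = 1∣ n
^-cancelˡ-∣ {p} pp (suc k) m n p∤m p^∣ with euclidsLemma m n pp (m*n∣⇒m∣ p (p ^ k) p^∣)
... | inj₁ p∣m = contradiction p∣m p∤m
... | inj₂ (divides c refl) =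
  subst (p ^ suc k ∣_) (*-comm p c)
    (*-monoʳ-∣ p (^-cancelˡ-∣ pp k m c p∤m
      (*-cancelˡ-∣ p {{prime⇒nonZero pp}} (subst (p ^ suc k ∣_) (shift m c p) p^∣))))
  where
  shift : ∀ m c p → m * (c * p) ≡ p * (m * c)
  shift = solve-∀

-- Divide `X` by the first prime power: the remaining ones are powers of other primes, so they still
-- divide the quotient `Y`.
product-^-∣ : ∀ (e : ℕ → ℕ) X ps → Unique ps → All Prime ps → All (λ p → p ^ e p ∣ X) ps →
              product (map (λ p → p ^ e p) ps) ∣ X
product-^-∣ e X [] _ _ _ = 1∣ X
product-^-∣ e .(Y * p ^ e p) (p ∷ ps) (p∉ ∷ ups) (pp ∷ pps) (divides Y refl ∷ ds) =
  subst (_∣ Y * p ^ e p) (*-comm _ (p ^ e p))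
    (*-monoˡ-∣ (p ^ e p) (product-^-∣ e Y ps ups pps (rest p∉ pps ds)))
  where
  rest : ∀ {qs} → All (p ≢_) qs → All Prime qs → All (λ q → q ^ e q ∣ Y * p ^ e p) qs → All (λ q → q ^ e q ∣ Y) qs
  rest [] [] [] = []
  rest {q ∷ _} (p≢q ∷ a) (pq ∷ b) (d ∷ c) =
    ^-cancelˡ-∣ pq (e q) (p ^ e p) Y
      (λ q∣ → p≢q (sym (prime∣prime⇒≡ pq pp (prime∣^⇒∣ pq p (e p) q∣))))
      (subst (q ^ e q ∣_) (*-comm Y _) d) ∷ rest a b c

product-primes-∣ : ∀ X ps → Unique ps → All Prime ps → All (_∣ X) ps → product ps ∣ X
product-primes-∣ X ps ups pps ds =
  subst (_∣ X) (cong product (map-^1 ps))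
    (product-^-∣ (λ _ → 1) X ps ups pps (All.map (λ {p} → subst (_∣ X) (sym (^-identityʳ p))) ds))
  where
  map-^1 : ∀ qs → map (_^ 1) qs ≡ qs
  map-^1 []       = refl
  map-^1 (q ∷ qs) = cong₂ _∷_ (^-identityʳ q) (map-^1 qs)

-- Induction along the factorisation of `m`. The hypothesis at exponent 1 cancels one prime `p` from
-- both `m` and `X`; it survives for the quotients, with the exponent of `p` itself shifted by one.
∣-by-prime-powers : ∀ m .{{_ : NonZero m}} X → (∀ p k → Prime p → p ^ k ∣ m → p ^ k ∣ X) → m ∣ X
∣-by-prime-powers m X h with factorise m
... | record { factors = ps ; isFactorisation = refl ; factorsPrime = pps } = go ps pps X h
  where
  go : ∀ ps → All Prime ps → ∀ X → (∀ p k → Prime p → p ^ k ∣ product ps → p ^ k ∣ X) → product ps ∣ X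
  go [] _ X _ = 1∣ X
  go (p ∷ ps) (pp ∷ pps) X h
    with h p 1 pp (subst (_∣ p * product ps) (sym (^-identityʳ p)) (m∣m*n (product ps)))
  ... | divides Y refl = subst (_∣ Y * (p * 1)) (*-comm (product ps) p)
          (subst (λ z → product ps * p ∣ Y * z) (sym (*-identityʳ p)) (*-monoˡ-∣ p (go ps pps Y h′)))
    where
    instance _ = prime⇒nonZero pp
    eqY : Y * (p * 1) ≡ p * Y
    eqY = trans (cong (Y *_) (*-identityʳ p)) (*-comm Y p)
    h′ : ∀ q k → Prime q → q ^ k ∣ product ps → q ^ k ∣ Y
    h′ q k pq q^∣ with q ≟ p
    ... | yes refl = *-cancelˡ-∣ p (subst (p ^ suc k ∣_) eqY (h p (suc k) pp (*-monoʳ-∣ p q^∣)))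
    ... | no q≢p   = ^-cancelˡ-∣ pq k p Y (q≢p ∘ prime∣prime⇒≡ pq pp)
                       (subst (q ^ k ∣_) eqY (h q k pq (∣n⇒∣m*n p q^∣)))

prime-divisor : ∀ n → 2 ≤ n → ∃[ p ] (Prime p × p ∣ n)
prime-divisor n 2≤n with factorise n {{>-nonZero (≤-trans (s≤s z≤n) 2≤n)}}
... | record { factors = [] ; isFactorisation = refl } = contradiction 2≤n λ { (s≤s ()) }
... | record { factors = p ∷ ps ; isFactorisation = refl ; factorsPrime = pp ∷ _ } = p , pp , m∣m*n (product ps)

-- Counting by indicator sums

ind : ∀ {P : Set} → Dec P → ℕ
ind (yes _) = 1
ind (no _)  = 0

∑ : (ℕ → ℕ) → ℕ → ℕ
∑ f zero    = 0
∑ f (suc n) = ∑ f n + f (suc n)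

range1-∷ʳ : ∀ n → range1 (suc n) ≡ range1 n ++ suc n ∷ []
range1-∷ʳ n = trans (cong (map suc) (sym (upTo-∷ʳ n))) (map-++ suc (upTo n) (n ∷ []))

length-filter-∑ : ∀ {P : ℕ → Set} (P? : Decidable P) n → length (filter P? (range1 n)) ≡ ∑ (λ k → ind (P? k)) n
length-filter-∑ P? zero = refl
length-filter-∑ P? (suc n) = begin
  length (filter P? (range1 (suc n)))                                ≡⟨ cong (length ∘ filter P?) (range1-∷ʳ n) ⟩
  length (filter P? (range1 n ++ suc n ∷ []))                        ≡⟨ cong length (filter-++ P? (range1 n) _) ⟩
  length (filter P? (range1 n) ++ filter P? (suc n ∷ []))            ≡⟨ length-++ (filter P? (range1 n)) ⟩
  length (filter P? (range1 n)) + length (filter P? (suc n ∷ []))    ≡⟨ cong₂ _+_ (length-filter-∑ P? n) last ⟩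
  ∑ (λ k → ind (P? k)) (suc n)                                       ∎
  where
  open ≡-Reasoning
  last : length (filter P? (suc n ∷ [])) ≡ ind (P? (suc n))
  last with P? (suc n)
  ... | yes _ = refl
  ... | no _  = refl

module _ {Q : ℕ → Set} (Q? : Decidable Q) (anti : ∀ {a b} → a ≤ b → Q b → Q a) where

  ∑-antitone-≤ : ∀ n → ∑ (λ a → ind (Q? a)) n ≤ n
  ∑-antitone-≤ zero = z≤n
  ∑-antitone-≤ (suc n) with Q? (suc n)
  ... | yes _ = ≤-trans (≤-reflexive (+-comm _ 1)) (s≤s (∑-antitone-≤ n))
  ... | no _  = ≤-trans (≤-reflexive (+-identityʳ _)) (m≤n⇒m≤1+n (∑-antitone-≤ n))

  -- Counting a downward closed set of exponents returns its largest element. Together with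
  -- `∑-antitone⁻` this is how both `val` and `floorLog` are read as maxima.
  ∑-antitone⁺ : ∀ n a → a ≤ n → Q a → a ≤ ∑ (λ a → ind (Q? a)) n
  ∑-antitone⁺ zero a a≤n qa = a≤n
  ∑-antitone⁺ (suc n) a a≤1+n qa with Q? (suc n) | m≤n⇒m<n∨m≡n a≤1+n
  ... | _     | inj₁ (s≤s a≤n) = ≤-trans (∑-antitone⁺ n a a≤n qa) (m≤m+n _ _)
  ... | yes q | inj₂ refl = ≤-trans (s≤s (∑-antitone⁺ n n ≤-refl (anti (n≤1+n n) q))) (≤-reflexive (+-comm 1 _))
  ... | no ¬q | inj₂ refl = contradiction qa ¬q

  ∑-antitone⁻ : ∀ n a → Q 0 → a ≤ ∑ (λ a → ind (Q? a)) n → Q a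
  ∑-antitone⁻ zero zero q0 a≤ = q0
  ∑-antitone⁻ (suc n) a q0 a≤ with Q? (suc n)
  ... | no _  = ∑-antitone⁻ n a q0 (≤-trans a≤ (≤-reflexive (+-identityʳ _)))
  ... | yes q = anti (≤-trans a≤ (≤-trans (≤-reflexive (+-comm _ 1)) (s≤s (∑-antitone-≤ n)))) q

-- Valuations and the factorisation into prime-power parts

^-mono-∣ : ∀ p {a b} → a ≤ b → p ^ a ∣ p ^ b
^-mono-∣ p {a} {b} a≤b = subst (p ^ a ∣_) (trans (sym (^-distribˡ-+-* p a (b ∸ a))) (cong (p ^_) (m+[n∸m]≡n a≤b))) (m∣m*n _)

-- An exponent `a` with `p ^ a ∣ n` or `p ^ a ≤ n` is below `n` for `n ≥ 1`, so the cutoff at `n` in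
-- `val` and `floorLog` loses nothing.
n<p^n : ∀ {p} → 2 ≤ p → ∀ n → n < p ^ n
n<p^n 2≤p zero = s≤s z≤n
n<p^n {p} 2≤p (suc n) = begin-strict
  suc n           ≤⟨ n<p^n 2≤p n ⟩
  p ^ n           <⟨ m<m+n (p ^ n) (≤-trans (s≤s z≤n) (n<p^n 2≤p n)) ⟩
  p ^ n + p ^ n   ≡⟨ cong (p ^ n +_) (sym (+-identityʳ _)) ⟩
  2 * p ^ n       ≤⟨ *-monoˡ-≤ (p ^ n) 2≤p ⟩
  p * p ^ n       ∎
  where open ≤-Reasoning

module _ {p n} (2≤p : 2 ≤ p) .{{_ : NonZero n}} where

  private
    anti : ∀ {a b} → a ≤ b → p ^ b ∣ n → p ^ a ∣ n
    anti a≤b = ∣-trans (^-mono-∣ p a≤b)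

  ∣⇒≤val : ∀ {a} → p ^ a ∣ n → a ≤ val p n
  ∣⇒≤val {a} d = subst (a ≤_) (sym (length-filter-∑ (λ a → (p ^ a) ∣? n) n))
    (∑-antitone⁺ (λ a → (p ^ a) ∣? n) anti n a (≤-trans (<⇒≤ (n<p^n 2≤p a)) (∣⇒≤ d)) d)

  p^val∣n : p ^ val p n ∣ n
  p^val∣n = ∑-antitone⁻ (λ a → (p ^ a) ∣? n) anti n (val p n) (1∣ n)
    (≤-reflexive (length-filter-∑ (λ a → (p ^ a) ∣? n) n))

  p≤p^val : p ∣ n → p ≤ p ^ val p n
  p≤p^val p∣n = ≤-trans (≤-reflexive (sym (^-identityʳ p)))
    (^-monoʳ-≤ p {{>-nonZero (<⇒≤ 2≤p)}} (∣⇒≤val {1} (subst (_∣ n) (sym (^-identityʳ p)) p∣n)))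

primeDivisors : ℕ → List ℕ
primeDivisors n = filter (λ p → p ∣? n) (filter prime? (range1 n))

range1-unique : ∀ n → Unique (range1 n)
range1-unique n = Unique.map⁺ suc-injective (Unique.upTo⁺ n)

∈-range1⁺ : ∀ {k n} → 1 ≤ k → k ≤ n → k ∈ range1 n
∈-range1⁺ {suc k} _ k<n = ∈-map⁺ suc (∈-upTo⁺ k<n)

primeDivisors-unique : ∀ n → Unique (primeDivisors n)
primeDivisors-unique n = Unique.filter⁺ _ (Unique.filter⁺ prime? (range1-unique n))

∈-primeDivisors⁻ : ∀ {p} n → p ∈ primeDivisors n → Prime p × p ∣ n
∈-primeDivisors⁻ n p∈ with ∈-filter⁻ (_∣? n) {xs = filter prime? (range1 n)} p∈
... | p∈′ , p∣n = proj₂ (∈-filter⁻ prime? {xs = range1 n} p∈′) , p∣n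

∈-primeDivisors⁺ : ∀ {p n} .{{_ : NonZero n}} → Prime p → p ∣ n → p ∈ primeDivisors n
∈-primeDivisors⁺ {p} {n} pp p∣n =
  ∈-filter⁺ (_∣? n) (∈-filter⁺ prime? (∈-range1⁺ (<⇒≤ (prime⇒2≤ pp)) (∣⇒≤ p∣n)) pp) p∣n

primeDivisors-prime : ∀ n → All Prime (primeDivisors n)
primeDivisors-prime n = All.tabulate (proj₁ ∘ ∈-primeDivisors⁻ n)

unitaryParts : ℕ → List ℕ
unitaryParts n = map (λ p → p ^ val p n) (primeDivisors n)

-- Divisibility in both directions: the parts are powers of distinct primes, each dividing `n`, and
-- a prime power dividing `n` divides the part of its own prime.
product-unitaryParts : ∀ n .{{_ : NonZero n}} → product (unitaryParts n) ≡ n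
product-unitaryParts n = ∣-antisym
  (product-^-∣ (λ p → val p n) n (primeDivisors n) (primeDivisors-unique n) (primeDivisors-prime n)
    (All.map (λ pp → p^val∣n (prime⇒2≤ pp)) (primeDivisors-prime n)))
  (∣-by-prime-powers n _ part)
  where
  part : ∀ p k → Prime p → p ^ k ∣ n → p ^ k ∣ product (unitaryParts n)
  part p zero    pp d = 1∣ _
  part p (suc k) pp d = ∣-trans (^-mono-∣ p (∣⇒≤val (prime⇒2≤ pp) {suc k} d))
    (∈⇒∣product (∈-map⁺ (λ p → p ^ val p n) (∈-primeDivisors⁺ pp (m*n∣⇒m∣ p (p ^ k) d))))

-- Bounds for the unitary Euler function

-- The inequality 1 - ∑ 1/dᵢ ≤ ∏ (1 - 1/dᵢ) with every 1/dᵢ ≤ 1/R, cleared of denominators.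
product-pred-≥ : ∀ R ds → All (R ≤_) ds →
                 R * product ds ≤ R * product (map (_∸ 1) ds) + length ds * product ds
product-pred-≥ R [] [] = m≤m+n _ _
product-pred-≥ R (zero ∷ ds) (_ ∷ _) = ≤-trans (≤-reflexive (*-zeroʳ R)) z≤n
product-pred-≥ R (suc e ∷ ds) (R≤d ∷ R≤ds) = begin
  R * (suc e * P)                              ≡⟨ split R e P ⟩
  e * (R * P) + R * P                          ≤⟨ +-mono-≤ (*-monoʳ-≤ e (product-pred-≥ R ds R≤ds)) (*-monoˡ-≤ P R≤d) ⟩
  -- The extra `l * P` rounds the coefficient `e` of `l * P` up to `suc e`.
  e * (R * Q + l * P) + suc e * P              ≤⟨ m≤m+n _ (l * P) ⟩
  e * (R * Q + l * P) + suc e * P + l * P      ≡⟨ merge R e P Q l ⟩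
  R * (e * Q) + suc l * (suc e * P)            ∎
  where
  open ≤-Reasoning
  P = product ds
  Q = product (map (_∸ 1) ds)
  l = length ds
  split : ∀ R e P → R * (suc e * P) ≡ e * (R * P) + R * P
  split = solve-∀
  merge : ∀ R e P Q l → e * (R * Q + l * P) + suc e * P + l * P ≡ R * (e * Q) + suc l * (suc e * P)
  merge = solve-∀

product-pred-≤ : ∀ ds → product (map (_∸ 1) ds) ≤ product ds
product-pred-≤ []       = ≤-refl
product-pred-≤ (d ∷ ds) = *-mono-≤ (m∸n≤m d 1) (product-pred-≤ ds)

^-length≤product : ∀ R ds → All (R ≤_) ds → R ^ length ds ≤ product ds
^-length≤product R [] [] = ≤-refl
^-length≤product R (d ∷ ds) (R≤d ∷ R≤ds) = *-mono-≤ R≤d (^-length≤product R ds R≤ds)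

product≤^-length : ∀ R ds → All (_≤ R) ds → product ds ≤ R ^ length ds
product≤^-length R [] [] = ≤-refl
product≤^-length R (d ∷ ds) (d≤R ∷ ds≤R) = *-mono-≤ d≤R (product≤^-length R ds ds≤R)

^-cancelʳ-≤ : ∀ {R} → 2 ≤ R → ∀ {a b} → R ^ a ≤ R ^ b → a ≤ b
^-cancelʳ-≤ {R} 2≤R {a} {b} le with a ≤? b
... | yes a≤b = a≤b
... | no a≰b  = contradiction le (<⇒≱ (^-monoʳ-< R 2≤R (≰⇒> a≰b)))

φ*-unitaryParts : ∀ n → φ* n ≡ product (map (_∸ 1) (unitaryParts n))
φ*-unitaryParts n = cong product (map-∘ (primeDivisors n))

φ*≤ : ∀ n .{{_ : NonZero n}} → φ* n ≤ n
φ*≤ n = begin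
  φ* n                                     ≡⟨ φ*-unitaryParts n ⟩
  product (map (_∸ 1) (unitaryParts n))    ≤⟨ product-pred-≤ (unitaryParts n) ⟩
  product (unitaryParts n)                 ≡⟨ product-unitaryParts n ⟩
  n                                        ∎
  where open ≤-Reasoning

φ*>0 : ∀ n .{{_ : NonZero n}} → 1 ≤ φ* n
φ*>0 n = subst (1 ≤_) (sym (φ*-unitaryParts n)) (go (unitaryParts n) (All.map⁺ (All.tabulate part)))
  where
  go : ∀ ds → All (2 ≤_) ds → 1 ≤ product (map (_∸ 1) ds)
  go [] [] = ≤-refl
  go (d ∷ ds) (2≤d ∷ 2≤ds) = *-mono-≤ (∸-monoˡ-≤ 1 2≤d) (go ds 2≤ds)
  part : ∀ {p} → p ∈ primeDivisors n → 2 ≤ p ^ val p n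
  part {p} p∈ with ∈-primeDivisors⁻ n p∈
  ... | pp , p∣n = ≤-trans (prime⇒2≤ pp) (p≤p^val (prime⇒2≤ pp) p∣n)

-- The parts multiply to `n ≤ R ^ B` and are at least `R` each, so there are at most `B` of them;
-- `product-pred-≥` charges `n / R` for each.
φ*-lower-bound : ∀ {R n} B .{{_ : NonZero n}} → 2 ≤ R → (∀ {p} → Prime p → p ∣ n → R ≤ p ^ val p n) → n ≤ R ^ B →
                 R * n ≤ R * φ* n + B * n
φ*-lower-bound {R} {n} B 2≤R R≤ n≤ = begin
  R * n                                                       ≡⟨ cong (R *_) (product-unitaryParts n) ⟨
  R * product ds                                              ≤⟨ product-pred-≥ R ds R≤ds ⟩
  R * product (map (_∸ 1) ds) + length ds * product ds        ≡⟨ cong₂ (λ u v → R * u + length ds * v) (φ*-unitaryParts n) (sym (product-unitaryParts n)) ⟨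
  R * φ* n + length ds * n                                    ≤⟨ +-monoʳ-≤ (R * φ* n) (*-monoˡ-≤ n len≤) ⟩
  R * φ* n + B * n                                            ∎
  where
  open ≤-Reasoning
  ds = unitaryParts n
  R≤ds : All (R ≤_) ds
  R≤ds = All.map⁺ (All.tabulate λ p∈ → let (pp , p∣n) = ∈-primeDivisors⁻ n p∈ in R≤ pp p∣n)
  len≤ : length ds ≤ B
  len≤ = ^-cancelʳ-≤ 2≤R (≤-trans (≤-trans (^-length≤product R ds R≤ds) (≤-reflexive (product-unitaryParts n))) n≤)

-- Finite sums: splitting, periodicity, multiples

ind-cong : ∀ {P Q : Set} → (P → Q) → (Q → P) → (d : Dec P) (e : Dec Q) → ind d ≡ ind e
ind-cong f g (yes p) (yes q) = refl
ind-cong f g (yes p) (no ¬q) = contradiction (f p) ¬q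
ind-cong f g (no ¬p) (yes q) = contradiction (g q) ¬p
ind-cong f g (no ¬p) (no ¬q) = refl

ind-yes : ∀ {P : Set} (d : Dec P) → P → ind d ≡ 1
ind-yes d p = ind-cong (λ _ → p) (λ _ → p) d (yes p)

ind-no : ∀ {P : Set} (d : Dec P) → ¬ P → ind d ≡ 0
ind-no d ¬p = ind-cong id id d (no ¬p)

∑-cong : ∀ {f g} n → (∀ k → 1 ≤ k → k ≤ n → f k ≡ g k) → ∑ f n ≡ ∑ g n
∑-cong zero    eq = refl
∑-cong (suc n) eq = cong₂ _+_ (∑-cong n (λ k 1≤k k≤n → eq k 1≤k (m≤n⇒m≤1+n k≤n))) (eq (suc n) (s≤s z≤n) ≤-refl)

∑-mono : ∀ {f g} n → (∀ k → f k ≤ g k) → ∑ f n ≤ ∑ g n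
∑-mono zero    le = z≤n
∑-mono (suc n) le = +-mono-≤ (∑-mono n le) (le (suc n))

∑-distrib-+ : ∀ f g n → ∑ (λ k → f k + g k) n ≡ ∑ f n + ∑ g n
∑-distrib-+ f g zero    = refl
∑-distrib-+ f g (suc n) = trans (cong (_+ (f (suc n) + g (suc n))) (∑-distrib-+ f g n)) (interchange (∑ f n) (∑ g n) (f (suc n)) (g (suc n)))
  where
  interchange : ∀ a b c d → a + b + (c + d) ≡ a + c + (b + d)
  interchange = solve-∀

∑-const : ∀ c n → ∑ (λ _ → c) n ≡ n * c
∑-const c zero    = refl
∑-const c (suc n) = trans (cong (_+ c) (∑-const c n)) (+-comm (n * c) c)

∑-split : ∀ f a b → ∑ f (a + b) ≡ ∑ f a + ∑ (λ k → f (a + k)) b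
∑-split f a zero    = trans (cong (∑ f) (+-identityʳ a)) (sym (+-identityʳ _))
∑-split f a (suc b) = begin
  ∑ f (a + suc b)                                              ≡⟨ cong (∑ f) (+-suc a b) ⟩
  ∑ f (a + b) + f (suc (a + b))                                ≡⟨ cong₂ _+_ (∑-split f a b) (cong f (sym (+-suc a b))) ⟩
  ∑ f a + ∑ (λ k → f (a + k)) b + f (a + suc b)                ≡⟨ +-assoc (∑ f a) _ _ ⟩
  ∑ f a + (∑ (λ k → f (a + k)) b + f (a + suc b))              ∎
  where open ≡-Reasoning

∑-swap : ∀ (f : ℕ → ℕ → ℕ) ps n → ∑ (λ k → sum (map (λ p → f p k) ps)) n ≡ sum (map (λ p → ∑ (f p) n) ps)
∑-swap f [] n       = trans (∑-const 0 n) (*-zeroʳ n)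
∑-swap f (p ∷ ps) n = trans (∑-distrib-+ (f p) _ n) (cong (∑ (f p) n +_) (∑-swap f ps n))

∑-periodic : ∀ f n → (∀ k → f (n + k) ≡ f k) → ∀ c → ∑ f (c * n) ≡ c * ∑ f n
∑-periodic f n per zero    = refl
∑-periodic f n per (suc c) = begin
  ∑ f (n + c * n)                         ≡⟨ ∑-split f n (c * n) ⟩
  ∑ f n + ∑ (λ k → f (n + k)) (c * n)     ≡⟨ cong (∑ f n +_) (∑-cong (c * n) (λ k _ _ → per k)) ⟩
  ∑ f n + ∑ f (c * n)                     ≡⟨ cong (∑ f n +_) (∑-periodic f n per c) ⟩
  ∑ f n + c * ∑ f n                       ∎
  where open ≡-Reasoning

-- Cut the range into blocks of length `p`: the only multiple of `p` in a block is its last element.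
∑-multiples : ∀ p .{{_ : NonZero p}} (g : ℕ → ℕ) n → ∑ (λ k → ind (p ∣? k) * g k) (n * p) ≡ ∑ (λ j → g (j * p)) n
∑-multiples p@(suc p′) g zero    = refl
∑-multiples p@(suc p′) g (suc n) = begin
  ∑ f (p + n * p)                                      ≡⟨ cong (∑ f) (+-comm p (n * p)) ⟩
  ∑ f (n * p + p)                                      ≡⟨ ∑-split f (n * p) p ⟩
  ∑ f (n * p) + (∑ (λ k → f (n * p + k)) p′ + f (n * p + p))
    ≡⟨ cong₂ _+_ (∑-multiples p g n) (cong₂ _+_ zeros last) ⟩
  ∑ (λ j → g (j * p)) n + g (suc n * p)                ∎
  where
  open ≡-Reasoning
  f = λ k → ind (p ∣? k) * g k
  zeros : ∑ (λ k → f (n * p + k)) p′ ≡ 0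
  zeros = trans (∑-cong {g = λ _ → 0} p′ λ k 1≤k k≤p′ →
            cong (_* g (n * p + k)) (ind-no (p ∣? (n * p + k)) λ p∣ →
              <⇒≱ (s≤s k≤p′) (∣⇒≤ {{>-nonZero 1≤k}} (∣m+n∣m⇒∣n p∣ (n∣m*n n)))))
          (trans (∑-const 0 p′) (*-zeroʳ p′))
  last : f (n * p + p) ≡ g (suc n * p)
  last = trans (cong f (+-comm (n * p) p))
           (trans (cong (_* g (suc n * p)) (ind-yes (p ∣? (suc n * p)) (n∣m*n (suc n)))) (+-identityʳ _))

-- Euler's totient: lower bound and values at products of distinct primes

gcd≡1⇒¬common : ∀ {p} → Prime p → ∀ {m n} → gcd m n ≡ 1 → p ∣ m → ¬ p ∣ n
gcd≡1⇒¬common {p} pp eq p∣m p∣n = ¬prime[1] (subst Prime (∣1⇒≡1 (subst (p ∣_) eq (gcd-greatest p∣m p∣n))) pp)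

gcd≢1⇒common-prime : ∀ m n .{{_ : NonZero n}} → gcd m n ≢ 1 → ∃[ p ] (Prime p × p ∣ m × p ∣ n)
gcd≢1⇒common-prime m n ≢1 with prime-divisor (gcd m n) (≤∧≢⇒< (n≢0⇒n>0 (gcd[m,n]≢0 m n (inj₂ (≢-nonZero⁻¹ n)))) (≢-sym ≢1))
... | p , pp , p∣g = p , pp , ∣-trans p∣g (gcd[m,n]∣m m n) , ∣-trans p∣g (gcd[m,n]∣n m n)

no-common-prime⇒gcd≡1 : ∀ m n .{{_ : NonZero n}} → (∀ {p} → Prime p → p ∣ m → ¬ p ∣ n) → gcd m n ≡ 1
no-common-prime⇒gcd≡1 m n h with gcd m n ≟ 1
... | yes eq = eq
... | no ≢1  = let (p , pp , p∣m , p∣n) = gcd≢1⇒common-prime m n ≢1 in contradiction p∣n (h pp p∣m)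

φ-∑ : ∀ n → φ n ≡ ∑ (λ k → ind (gcd k n ≟ 1)) n
φ-∑ n = length-filter-∑ (λ k → gcd k n ≟ 1) n

φ≤ : ∀ n → φ n ≤ n
φ≤ n = begin
  φ n                            ≡⟨ φ-∑ n ⟩
  ∑ (λ k → ind (gcd k n ≟ 1)) n  ≤⟨ ∑-mono n (λ k → ind≤1 (gcd k n ≟ 1)) ⟩
  ∑ (λ _ → 1) n                  ≡⟨ trans (∑-const 1 n) (*-identityʳ n) ⟩
  n                              ∎
  where
  open ≤-Reasoning
  ind≤1 : ∀ {P : Set} (d : Dec P) → ind d ≤ 1
  ind≤1 (yes _) = ≤-refl
  ind≤1 (no _)  = z≤n

-- Each `k` up to `n` is either coprime to `n` or a multiple of some prime divisor of `n`; multiples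
-- of several of them are simply counted several times.
φ-union-bound : ∀ n .{{_ : NonZero n}} → n ≤ φ n + sum (map (λ p → ∑ (λ k → ind (p ∣? k)) n) (primeDivisors n))
φ-union-bound n = begin
  n                                                                        ≡⟨ trans (∑-const 1 n) (*-identityʳ n) ⟨
  ∑ (λ _ → 1) n                                                            ≤⟨ ∑-mono n pointwise ⟩
  ∑ (λ k → ind (gcd k n ≟ 1) + sum (map (λ p → ind (p ∣? k)) ps)) n        ≡⟨ ∑-distrib-+ _ _ n ⟩
  ∑ (λ k → ind (gcd k n ≟ 1)) n + ∑ (λ k → sum (map (λ p → ind (p ∣? k)) ps)) n
    ≡⟨ cong₂ _+_ (sym (φ-∑ n)) (∑-swap (λ p k → ind (p ∣? k)) ps n) ⟩
  φ n + sum (map (λ p → ∑ (λ k → ind (p ∣? k)) n) ps)                      ∎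
  where
  open ≤-Reasoning
  ps = primeDivisors n
  hit : ∀ {p} k {qs} → p ∈ qs → p ∣ k → 1 ≤ sum (map (λ p → ind (p ∣? k)) qs)
  hit {p} k (here refl) p∣k = ≤-trans (≤-reflexive (sym (ind-yes (p ∣? k) p∣k))) (m≤m+n _ _)
  hit k (there p∈) p∣k      = ≤-trans (hit k p∈ p∣k) (m≤n+m _ _)
  pointwise : ∀ k → 1 ≤ ind (gcd k n ≟ 1) + sum (map (λ p → ind (p ∣? k)) ps)
  pointwise k with gcd k n ≟ 1
  ... | yes _ = s≤s z≤n
  ... | no ≢1 = let (p , pp , p∣k , p∣n) = gcd≢1⇒common-prime k n ≢1 in hit k (∈-primeDivisors⁺ pp p∣n) p∣k

-- In the union bound a prime `p ∣ n` accounts for `n / p ≤ n / R` multiples. The prime divisors are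
-- at least `R` and their product divides `n ≤ R ^ B`, so there are at most `B` of them.
φ-lower-bound : ∀ {R n} B .{{_ : NonZero n}} → 2 ≤ R → (∀ {p} → Prime p → p ∣ n → R ≤ p) → n ≤ R ^ B →
                R * n ≤ R * φ n + B * n
φ-lower-bound {R} {n} B 2≤R R≤ n≤ = begin
  R * n                                       ≤⟨ *-monoʳ-≤ R (φ-union-bound n) ⟩
  R * (φ n + sum (map multiples ps))          ≡⟨ *-distribˡ-+ R (φ n) _ ⟩
  R * φ n + R * sum (map multiples ps)        ≤⟨ +-monoʳ-≤ (R * φ n) (sum-bound ps (All.tabulate (∈-primeDivisors⁻ n))) ⟩
  R * φ n + length ps * n                     ≤⟨ +-monoʳ-≤ (R * φ n) (*-monoˡ-≤ n len≤) ⟩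
  R * φ n + B * n                             ∎
  where
  open ≤-Reasoning
  ps = primeDivisors n
  multiples : ℕ → ℕ
  multiples p = ∑ (λ k → ind (p ∣? k)) n
  R*multiples≤ : ∀ {p} → Prime p → p ∣ n → R * multiples p ≤ n
  R*multiples≤ {p} pp p∣n@(divides c refl) = begin
    R * ∑ (λ k → ind (p ∣? k)) (c * p)         ≡⟨ cong (R *_) (∑-cong (c * p) (λ k _ _ → sym (*-identityʳ _))) ⟩
    R * ∑ (λ k → ind (p ∣? k) * 1) (c * p)     ≡⟨ cong (R *_) (∑-multiples p {{prime⇒nonZero pp}} (λ _ → 1) c) ⟩
    R * ∑ (λ _ → 1) c                          ≡⟨ cong (R *_) (trans (∑-const 1 c) (*-identityʳ c)) ⟩
    R * c                                      ≤⟨ *-monoˡ-≤ c (R≤ pp p∣n) ⟩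
    p * c                                      ≡⟨ *-comm p c ⟩
    c * p                                      ∎
  sum-bound : ∀ qs → All (λ p → Prime p × p ∣ n) qs → R * sum (map multiples qs) ≤ length qs * n
  sum-bound [] [] = ≤-reflexive (*-zeroʳ R)
  sum-bound (q ∷ qs) ((pq , q∣n) ∷ rest) = ≤-trans (≤-reflexive (*-distribˡ-+ R (multiples q) _))
    (+-mono-≤ (R*multiples≤ pq q∣n) (sum-bound qs rest))
  len≤ : length ps ≤ B
  len≤ = ^-cancelʳ-≤ 2≤R (≤-trans (^-length≤product R ps (All.tabulate λ p∈ → let (pp , p∣n) = ∈-primeDivisors⁻ n p∈ in R≤ pp p∣n))
    (≤-trans (∣⇒≤ (product-primes-∣ n ps (primeDivisors-unique n) (primeDivisors-prime n)
      (All.tabulate (proj₂ ∘ ∈-primeDivisors⁻ n)))) n≤))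

-- Count the `k ≤ p * n` coprime to `n`. By periodicity there are `p * φ n`; those prime to `p`
-- number `φ (p * n)` and the multiples of `p` number `φ n`. Adding `φ n` on both sides avoids
-- subtraction.
φ-*-prime : ∀ {p n} .{{_ : NonZero n}} → Prime p → ¬ p ∣ n → φ (p * n) ≡ (p ∸ 1) * φ n
φ-*-prime {zero} pp _ = contradiction pp ¬prime[0]
φ-*-prime {p@(suc p′)} {n} pp p∤n = +-cancelʳ-≡ (φ n) _ _ (begin
  φ (p * n) + φ n                                                            ≡⟨ cong₂ _+_ (φ-∑ (p * n)) φn-multiples ⟩
  ∑ (λ k → ind (gcd k (p * n) ≟ 1)) (p * n) + ∑ (λ k → ind (p ∣? k) * g k) (p * n)  ≡⟨ ∑-distrib-+ _ _ (p * n) ⟨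
  ∑ (λ k → ind (gcd k (p * n) ≟ 1) + ind (p ∣? k) * g k) (p * n)             ≡⟨ ∑-cong (p * n) (λ k _ _ → pointwise k) ⟩
  ∑ g (p * n)                                                                ≡⟨ ∑-periodic g n periodic p ⟩
  p * ∑ g n                                                                  ≡⟨ cong (p *_) (sym (φ-∑ n)) ⟩
  φ n + p′ * φ n                                                             ≡⟨ +-comm (φ n) _ ⟩
  p′ * φ n + φ n                                                             ∎)
  where
  open ≡-Reasoning
  instance
    _ = prime⇒nonZero pp
    _ = m*n≢0 p n
  g : ℕ → ℕ
  g k = ind (gcd k n ≟ 1)
  periodic : ∀ k → g (n + k) ≡ g k
  periodic k = ind-cong
    (λ eq → no-common-prime⇒gcd≡1 k n λ pq q∣k q∣n → gcd≡1⇒¬common pq eq (∣m∣n⇒∣m+n q∣n q∣k) q∣n)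
    (λ eq → no-common-prime⇒gcd≡1 (n + k) n λ pq q∣n+k q∣n → gcd≡1⇒¬common pq eq (∣m+n∣m⇒∣n q∣n+k q∣n) q∣n)
    (gcd (n + k) n ≟ 1) (gcd k n ≟ 1)
  φn-multiples : φ n ≡ ∑ (λ k → ind (p ∣? k) * g k) (p * n)
  φn-multiples = begin
    φ n                                          ≡⟨ φ-∑ n ⟩
    ∑ g n                                        ≡⟨ ∑-cong n (λ j _ _ → scale j) ⟩
    ∑ (λ j → g (j * p)) n                        ≡⟨ ∑-multiples p g n ⟨
    ∑ (λ k → ind (p ∣? k) * g k) (n * p)         ≡⟨ cong (∑ _) (*-comm n p) ⟩
    ∑ (λ k → ind (p ∣? k) * g k) (p * n)         ∎
    where
    -- As `p` does not divide `n`, the factor `p` creates no new common prime with `n`.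
    scale : ∀ j → g j ≡ g (j * p)
    scale j = ind-cong
      (λ eq → no-common-prime⇒gcd≡1 (j * p) n λ pq q∣jp q∣n → [ (λ q∣j → gcd≡1⇒¬common pq eq q∣j q∣n)
        , (λ q∣p → p∤n (subst (_∣ n) (prime∣prime⇒≡ pq pp q∣p) q∣n)) ]′ (euclidsLemma j p pq q∣jp))
      (λ eq → no-common-prime⇒gcd≡1 j n λ pq q∣j → gcd≡1⇒¬common pq eq (∣m⇒∣m*n p q∣j))
      (gcd j n ≟ 1) (gcd (j * p) n ≟ 1)
  pointwise : ∀ k → ind (gcd k (p * n) ≟ 1) + ind (p ∣? k) * g k ≡ g k
  pointwise k with p ∣? k
  ... | yes p∣k = cong₂ _+_ (ind-no (gcd k (p * n) ≟ 1) λ eq → gcd≡1⇒¬common pp eq p∣k (m∣m*n n)) (+-identityʳ (g k))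
  ... | no p∤k  = trans (+-identityʳ _) (ind-cong
      (λ eq → no-common-prime⇒gcd≡1 k n λ pq q∣k q∣n → gcd≡1⇒¬common pq eq q∣k (∣n⇒∣m*n p q∣n))
      (λ eq → no-common-prime⇒gcd≡1 k (p * n) λ pq q∣k q∣pn → [ (λ q∣p → p∤k (subst (_∣ k) (prime∣prime⇒≡ pq pp q∣p) q∣k))
        , gcd≡1⇒¬common pq eq q∣k ]′ (euclidsLemma p n pq q∣pn))
      (gcd k (p * n) ≟ 1) (gcd k n ≟ 1))

∤product-distinct : ∀ {p} → Prime p → ∀ ps → All Prime ps → All (p ≢_) ps → ¬ p ∣ product ps
∤product-distinct pp ps pps p≢ p∣ with prime∣product⇒∃ pp ps p∣
... | q , q∈ , p∣q = All.lookup p≢ q∈ (prime∣prime⇒≡ pp (All.lookup pps q∈) p∣q)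

φ-product-primes : ∀ ps → Unique ps → All Prime ps → φ (product ps) ≡ product (map (_∸ 1) ps)
φ-product-primes [] _ _ = refl
φ-product-primes (p ∷ ps) (p∉ ∷ ups) (pp ∷ pps) =
  trans (φ-*-prime {{productOfPrimes≢0 pps}} pp (∤product-distinct pp ps pps p∉))
        (cong ((p ∸ 1) *_) (φ-product-primes ps ups pps))

-- Prime factors of Mersenne numbers

%≡⇒∣∸ : ∀ {q} .{{_ : NonZero q}} {a b} → a % q ≡ b % q → q ∣ b ∸ a
%≡⇒∣∸ {q} {a} {b} eq = divides (b / q ∸ a / q) (begin
  b ∸ a                                          ≡⟨ cong₂ _∸_ (m≡m%n+[m/n]*n b q) (m≡m%n+[m/n]*n a q) ⟩
  b % q + b / q * q ∸ (a % q + a / q * q)        ≡⟨ cong (λ r → b % q + b / q * q ∸ (r + a / q * q)) eq ⟩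
  b % q + b / q * q ∸ (b % q + a / q * q)        ≡⟨ [m+n]∸[m+o]≡n∸o (b % q) _ _ ⟩
  b / q * q ∸ a / q * q                          ≡⟨ *-distribʳ-∸ q (b / q) (a / q) ⟨
  (b / q ∸ a / q) * q                            ∎)
  where open ≡-Reasoning

pred-* : ∀ x y .{{_ : NonZero x}} .{{_ : NonZero y}} → x * y ∸ 1 ≡ x * (y ∸ 1) + (x ∸ 1)
pred-* (suc a) (suc b) = ring a b
  where
  ring : ∀ a b → b + a * suc b ≡ b + a * b + a
  ring = solve-∀

-- Induction with 2^(d + cd) - 1 = 2^d (2^(cd) - 1) + (2^d - 1), an instance of `pred-*`.
∣2^∸1-* : ∀ {q d} c → q ∣ 2 ^ d ∸ 1 → q ∣ 2 ^ (c * d) ∸ 1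
∣2^∸1-* zero q∣ = _ ∣0
∣2^∸1-* {q} {d} (suc c) q∣ =
  subst (q ∣_) (sym (trans (cong (_∸ 1) (^-distribˡ-+-* 2 d (c * d))) (pred-* (2 ^ d) (2 ^ (c * d)))))
    (∣m∣n⇒∣m+n (∣n⇒∣m*n (2 ^ d) (∣2^∸1-* {d = d} c q∣)) q∣)
  where
  instance
    _ = m^n≢0 2 d
    _ = m^n≢0 2 (c * d)

∣2^∸1⇒∤2^ : ∀ {q} → Prime q → ∀ a → q ∣ 2 ^ a ∸ 1 → ¬ q ∣ 2 ^ a
∣2^∸1⇒∤2^ {q} pq a q∣ q∣2^a = ¬prime[1] (subst Prime (∣1⇒≡1 (∣m+n∣m⇒∣n (subst (q ∣_) (sym (m∸n+n≡m (m^n>0 2 a))) q∣2^a) q∣)) pq)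

-- The two numbers differ by 2^a, so `q` would divide 2^a as well as 2^a - 1, hence 1.
consecutive-∤ : ∀ {q} → Prime q → ∀ a → q ∣ 2 ^ a ∸ 1 → ¬ q ∣ 2 ^ suc a ∸ 1
consecutive-∤ {q} pq a q∣ q∣s = ∣2^∸1⇒∤2^ pq a q∣ (∣m+n∣m⇒∣n (subst (q ∣_) (double (2 ^ a) {{m^n≢0 2 a}}) q∣s) q∣)
  where
  double : ∀ x .{{_ : NonZero x}} → 2 * x ∸ 1 ≡ (x ∸ 1) + x
  double (suc y) = cong (y +_) (+-identityʳ (suc y))

-- Among 2⁰, …, 2^q two powers agree modulo q, so q ∣ 2^d ∸ 1 for some 1 ≤ d ≤ q;
-- were q < p, then p and d would be coprime and q would divide 2 - 1.
prime∣2^p∸1⇒p≤ : ∀ {p q} → Prime p → Prime q → q ∣ 2 ^ p ∸ 1 → p ≤ q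
prime∣2^p∸1⇒p≤ {p} {q} pp pq q∣ with p ≤? q
... | yes p≤q = p≤q
... | no p≰q
  with pigeonhole (n<1+n q) (λ (i : Fin (suc q)) → fromℕ< (m%n<n (2 ^ toℕ i) q {{prime⇒nonZero pq}}))
...   | i , j , i<j , eq = bezout (coprime-Bézout (prime⇒coprime pp d<p))
  where
  instance
    _ = prime⇒nonZero pq
  d = toℕ j ∸ toℕ i
  instance
    d≢0 = >-nonZero (m<n⇒0<n∸m i<j)
  d<p : d < p
  d<p = ≤-<-trans (m∸n≤m (toℕ j) (toℕ i)) (≤-<-trans (toℕ≤pred[n] j) (≰⇒> p≰q))
  q∤2^ : ∀ k → ¬ q ∣ 2 ^ k
  -- If `q` divides a power of 2 it divides 2, hence also 2^p, against `q ∣ 2 ^ p ∸ 1`.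
  q∤2^ k q∣2^k = ∣2^∸1⇒∤2^ pq p q∣ (∣-trans (prime∣^⇒∣ pq 2 k q∣2^k) (^-mono-∣ 2 (<⇒≤ (prime⇒2≤ pp)) ))
  diff : 2 ^ toℕ j ∸ 2 ^ toℕ i ≡ 2 ^ toℕ i * (2 ^ d ∸ 1)
  diff = begin
    2 ^ toℕ j ∸ 2 ^ toℕ i                      ≡⟨ cong (λ e → 2 ^ e ∸ 2 ^ toℕ i) (sym (m+[n∸m]≡n (<⇒≤ i<j))) ⟩
    2 ^ (toℕ i + d) ∸ 2 ^ toℕ i                ≡⟨ cong₂ _∸_ (^-distribˡ-+-* 2 (toℕ i) d) (sym (*-identityʳ (2 ^ toℕ i))) ⟩
    2 ^ toℕ i * 2 ^ d ∸ 2 ^ toℕ i * 1          ≡⟨ *-distribˡ-∸ (2 ^ toℕ i) (2 ^ d) 1 ⟨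
    2 ^ toℕ i * (2 ^ d ∸ 1)                    ∎
    where open ≡-Reasoning
  q∣2^d∸1 : q ∣ 2 ^ d ∸ 1
  q∣2^d∸1 with euclidsLemma (2 ^ toℕ i) (2 ^ d ∸ 1) pq (subst (q ∣_) diff (%≡⇒∣∸ {q}
               (trans (sym (toℕ-fromℕ< _)) (trans (cong toℕ eq) (toℕ-fromℕ< _)))))
  ... | inj₁ bad = contradiction bad (q∤2^ (toℕ i))
  ... | inj₂ ok  = ok
  -- Bézout gives a multiple of `p` and a multiple of `d` that are consecutive; `q` divides 2^e - 1
  -- for both exponents, which `consecutive-∤` excludes.
  bezout : Bézout.Identity 1 p d → p ≤ q
  bezout (Bézout.+- x y e) = contradiction (subst (λ z → q ∣ 2 ^ z ∸ 1) (sym e) (∣2^∸1-* {d = p} x q∣))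
                               (consecutive-∤ pq (y * d) (∣2^∸1-* {d = d} y q∣2^d∸1))
  bezout (Bézout.-+ x y e) = contradiction (subst (λ z → q ∣ 2 ^ z ∸ 1) (sym e) (∣2^∸1-* {d = d} y q∣2^d∸1))
                               (consecutive-∤ pq (x * p) (∣2^∸1-* {d = p} x q∣))

-- Pruning a finite set against a list of weighted conditions

length-filter-¬ : ∀ {P : ℕ → Set} (P? : Decidable P) xs → length (filter P? xs) + length (filter (¬? ∘ P?) xs) ≡ length xs
length-filter-¬ P? [] = refl
length-filter-¬ P? (x ∷ xs) with P? x
... | yes _ = cong suc (length-filter-¬ P? xs)
... | no _  = trans (+-suc _ _) (cong suc (length-filter-¬ P? xs))

module _ {Q : ℕ → ℕ → Set} (Q? : ∀ r → Decidable (Q r)) (w : ℕ → ℕ) where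

  Pruned : List ℕ → List ℕ → Set
  Pruned rs S = ∀ {r} → r ∈ rs → filter (Q? r) S ≡ [] ⊎ w r < length (filter (Q? r) S)

  -- Discarding the at most w r elements related to r settles r for good, at a total cost below length S.
  prune : ∀ rs S → Unique S → sum (map w rs) < length S →
          ∃[ S′ ] (Unique S′ × (∀ {x} → x ∈ S′ → x ∈ S) × length S′ ≤ length S × 1 ≤ length S′ × Pruned rs S′)
  prune rs = go (length rs) rs refl
    where
    go : ∀ n rs → length rs ≡ n → ∀ S → Unique S → sum (map w rs) < length S →
         ∃[ S′ ] (Unique S′ × (∀ {x} → x ∈ S′ → x ∈ S) × length S′ ≤ length S × 1 ≤ length S′ × Pruned rs S′)
    go n rs len S uS cost with Any.any? (λ r → length (filter (Q? r) S) ≤? w r) rs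
    ... | no none = S , uS , id , ≤-refl , ≤-trans (s≤s z≤n) cost ,
                    λ r∈ → inj₂ (≰⇒> (All.lookup (All.¬Any⇒All¬ rs none) r∈))
    ... | yes some with find some
    ...   | r , r∈ , few with ∈-∃++ r∈
    go zero .(ys ++ r ∷ zs) len S uS cost | yes _ | r , _ , few | ys , zs , refl =
      contradiction (trans (sym (trans (length-++ ys) (+-suc (length ys) (length zs)))) len) λ ()
    go (suc n) .(ys ++ r ∷ zs) len S uS cost | yes _ | r , _ , few | ys , zs , refl
      with go n (ys ++ zs) len′ S₁ (Unique.filter⁺ (¬? ∘ Q? r) uS) cost′
      where
      S₁ = filter (¬? ∘ Q? r) S
      len′ : length (ys ++ zs) ≡ n
      len′ = suc-injective (trans (cong suc (length-++ ys)) (trans (sym (trans (length-++ ys) (+-suc (length ys) (length zs)))) len))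
      sum-middle : sum (map w (ys ++ r ∷ zs)) ≡ w r + sum (map w (ys ++ zs))
      sum-middle = begin
        sum (map w (ys ++ r ∷ zs))                       ≡⟨ trans (cong sum (map-++ w ys (r ∷ zs))) (sum-++ (map w ys) _) ⟩
        sum (map w ys) + (w r + sum (map w zs))          ≡⟨ swap (sum (map w ys)) (w r) _ ⟩
        w r + (sum (map w ys) + sum (map w zs))          ≡⟨ cong (w r +_) (trans (cong sum (map-++ w ys zs)) (sum-++ (map w ys) _)) ⟨
        w r + sum (map w (ys ++ zs))                     ∎
        where
        open ≡-Reasoning
        swap : ∀ a b c → a + (b + c) ≡ b + (a + c)
        swap = solve-∀
      cost′ : sum (map w (ys ++ zs)) < length S₁
      cost′ = +-cancelˡ-< (w r) _ _ (<-≤-trans (≤-<-trans (≤-reflexive (sym sum-middle)) cost)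
        (≤-trans (≤-reflexive (sym (length-filter-¬ (Q? r) S))) (+-monoˡ-≤ _ few)))
    ... | S′ , uS′ , S′⊆ , len≤ , nonempty , pruned =
      S′ , uS′ , (λ x∈ → proj₁ (∈-filter⁻ (¬? ∘ Q? r) (S′⊆ x∈))) , ≤-trans len≤ (length-filter (¬? ∘ Q? r) S) , nonempty , pruned′
      where
      pruned′ : Pruned (ys ++ r ∷ zs) S′
      pruned′ r′∈ with ∈-++⁻ ys r′∈
      ... | inj₁ l = pruned (∈-++⁺ˡ l)
      -- `r` stays settled: `S′` is contained in `S₁`, where nothing is related to `r`.
      ... | inj₂ (here refl) = inj₁ (filter-none (Q? r) (All.tabulate λ x∈ → proj₂ (∈-filter⁻ (¬? ∘ Q? r) {xs = S} (S′⊆ x∈))))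
      ... | inj₂ (there l) = pruned (∈-++⁺ʳ ys l)

-- Primes in half-open intervals

primesIn : ℕ → ℕ → List ℕ
primesIn lo len = filter prime? (applyUpTo (λ i → suc (lo + i)) len)

∈-primesIn⁻ : ∀ {p} lo len → p ∈ primesIn lo len → Prime p × lo < p × p ≤ lo + len
∈-primesIn⁻ {p} lo len p∈ with ∈-filter⁻ prime? {xs = applyUpTo (λ i → suc (lo + i)) len} p∈
... | p∈′ , pp with ∈-applyUpTo⁻ (λ i → suc (lo + i)) p∈′
...   | i , i<len , refl = pp , s≤s (m≤m+n lo i) , ≤-trans (≤-reflexive (sym (+-suc lo i))) (+-monoʳ-≤ lo i<len)

∈-primesIn⁺ : ∀ {p lo len} → Prime p → lo < p → p ≤ lo + len → p ∈ primesIn lo len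
∈-primesIn⁺ {p} {lo} {len} pp lo<p p≤ = ∈-filter⁺ prime? (subst (_∈ applyUpTo (λ i → suc (lo + i)) len) eq
    (∈-applyUpTo⁺ (λ i → suc (lo + i)) i<len)) pp
  where
  eq : suc (lo + (p ∸ suc lo)) ≡ p
  eq = m+[n∸m]≡n lo<p
  i<len : p ∸ suc lo < len
  i<len = +-cancelˡ-≤ lo _ _ (≤-trans (≤-reflexive (trans (+-suc lo _) eq)) p≤)

primesIn-prime : ∀ lo len → All Prime (primesIn lo len)
primesIn-prime lo len = All.tabulate (proj₁ ∘ ∈-primesIn⁻ lo len)

primesIn-unique : ∀ lo len → Unique (primesIn lo len)
primesIn-unique lo len = Unique.filter⁺ prime?
  (Unique.applyUpTo⁺₁ (λ i → suc (lo + i)) len λ i<j _ eq → <⇒≢ i<j (+-cancelˡ-≡ lo _ _ (suc-injective eq)))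

applyUpTo-++ : ∀ (f : ℕ → ℕ) a b → applyUpTo f (a + b) ≡ applyUpTo f a ++ applyUpTo (λ i → f (a + i)) b
applyUpTo-++ f zero    b = refl
applyUpTo-++ f (suc a) b = cong (f 0 ∷_) (applyUpTo-++ (f ∘ suc) a b)

applyUpTo-cong : ∀ {f g : ℕ → ℕ} → (∀ i → f i ≡ g i) → ∀ n → applyUpTo f n ≡ applyUpTo g n
applyUpTo-cong eq zero    = refl
applyUpTo-cong eq (suc n) = cong₂ _∷_ (eq 0) (applyUpTo-cong (eq ∘ suc) n)

primesIn-++ : ∀ lo a b → primesIn lo (a + b) ≡ primesIn lo a ++ primesIn (lo + a) b
primesIn-++ lo a b = begin
  primesIn lo (a + b)
    ≡⟨ cong (filter prime?) (applyUpTo-++ (λ i → suc (lo + i)) a b) ⟩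
  filter prime? (applyUpTo (λ i → suc (lo + i)) a ++ applyUpTo (λ i → suc (lo + (a + i))) b)
    ≡⟨ filter-++ prime? (applyUpTo (λ i → suc (lo + i)) a) _ ⟩
  primesIn lo a ++ filter prime? (applyUpTo (λ i → suc (lo + (a + i))) b)
    ≡⟨ cong (λ l → primesIn lo a ++ filter prime? l) (applyUpTo-cong (λ i → cong suc (sym (+-assoc lo a i))) b) ⟩
  primesIn lo a ++ primesIn (lo + a) b ∎
  where open ≡-Reasoning

length-primesIn : ∀ lo len → length (primesIn lo len) ≤ len
length-primesIn lo len = ≤-trans (length-filter prime? (applyUpTo (λ i → suc (lo + i)) len)) (≤-reflexive (length-applyUpTo (λ i → suc (lo + i)) len))

-- Chebyshev's upper bound via central binomial coefficients

nC0≡1 : ∀ n → n C 0 ≡ 1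
nC0≡1 n = trans (nCk≡nC[n∸k] {0} {n} z≤n) (nCn≡1 n)

nCk≤2^n : ∀ n k → n C k ≤ 2 ^ n
nCk≤2^n n zero          = ≤-trans (≤-reflexive (nC0≡1 n)) (m^n>0 2 n)
nCk≤2^n zero (suc k)    = ≤-trans (≤-reflexive (k>n⇒nCk≡0 {0} {suc k} (s≤s z≤n))) z≤n
nCk≤2^n (suc n) (suc k) = begin
  suc n C suc k              ≡⟨ nCk+nC[k+1]≡[n+1]C[k+1] n k ⟨
  n C k + n C suc k          ≤⟨ +-mono-≤ (nCk≤2^n n k) (nCk≤2^n n (suc k)) ⟩
  2 ^ n + 2 ^ n              ≡⟨ cong (2 ^ n +_) (+-identityʳ _) ⟨
  2 ^ suc n                  ∎
  where open ≤-Reasoning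

prime∣!⇒≤ : ∀ {p} → Prime p → ∀ n → p ∣ n ! → p ≤ n
prime∣!⇒≤ pp zero p∣    = contradiction (subst Prime (∣1⇒≡1 p∣) pp) ¬prime[1]
prime∣!⇒≤ pp (suc n) p∣ with euclidsLemma (suc n) (n !) pp p∣
... | inj₁ d = ∣⇒≤ d
... | inj₂ d = m≤n⇒m≤1+n (prime∣!⇒≤ pp n d)

≤⇒∣! : ∀ {m n} .{{_ : NonZero m}} → m ≤ n → m ∣ n !
≤⇒∣! {suc m} m≤n = ∣-trans (m∣m*n (m !)) (m≤n⇒m!∣n! m≤n)

[2n]Cn*n!*n! : ∀ n → ((n + n) C n) * (n ! * n !) ≡ (n + n) !
[2n]Cn*n!*n! n = begin
  ((n + n) C n) * (n ! * n !)                                      ≡⟨ cong (λ k → ((n + n) C n) * (n ! * k !)) (m+n∸n≡m n n) ⟨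
  ((n + n) C n) * (n ! * (n + n ∸ n) !)                            ≡⟨ cong (_* (n ! * (n + n ∸ n) !)) (nCk≡n!/k![n-k]! (m≤m+n n n)) ⟩
  (n + n) ! / (n ! * (n + n ∸ n) !) * (n ! * (n + n ∸ n) !)      ≡⟨ m/n*n≡m (k![n∸k]!∣n! (m≤m+n n n)) ⟩
  (n + n) !                                                      ∎
  where
  open ≡-Reasoning
  instance _ = n !* (n + n ∸ n) !≢0

-- A prime in (n, 2n] divides (2n)! but not n! n!, so it divides the central binomial coefficient,
-- which is at most 4^n.
product-primesIn-≤ : ∀ n → product (primesIn n n) ≤ 2 ^ (n + n)
product-primesIn-≤ n = ≤-trans (∣⇒≤ {{nonzero}} (product-primes-∣ ((n + n) C n) (primesIn n n) (primesIn-unique n n) (primesIn-prime n n)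
    (All.tabulate λ p∈ → dvd (∈-primesIn⁻ n n p∈)))) (nCk≤2^n (n + n) n)
  where
  nonzero : NonZero ((n + n) C n)
  nonzero = m*n≢0⇒m≢0 _ {{subst NonZero (sym ([2n]Cn*n!*n! n)) ((n + n) !≢0)}}
  dvd : ∀ {p} → Prime p × n < p × p ≤ n + n → p ∣ (n + n) C n
  dvd {p} (pp , n<p , p≤2n) with euclidsLemma ((n + n) C n) (n ! * n !) pp
    (subst (p ∣_) (sym ([2n]Cn*n!*n! n)) (≤⇒∣! {{prime⇒nonZero pp}} p≤2n))
  ... | inj₁ d = d
  ... | inj₂ d = contradiction ([ prime∣!⇒≤ pp n , prime∣!⇒≤ pp n ]′ (euclidsLemma (n !) (n !) pp d)) (<⇒≱ n<p)

-- Doubling: with x = 2^j, the primes up to 2x are those up to x, with product at most 2^(2x), and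
-- those in (x, 2x], with product at most 2^(2x) again.
primorial-2^-≤ : ∀ j → product (primesIn 0 (2 ^ j)) ≤ 2 ^ (2 * 2 ^ j)
primorial-2^-≤ zero    = s≤s z≤n
primorial-2^-≤ (suc j) = begin
  product (primesIn 0 (2 * x))                       ≡⟨ cong (λ z → product (primesIn 0 (x + z))) (+-identityʳ x) ⟩
  product (primesIn 0 (x + x))                       ≡⟨ trans (cong product (primesIn-++ 0 x x)) (product-++ (primesIn 0 x) _) ⟩
  product (primesIn 0 x) * product (primesIn x x)    ≤⟨ *-mono-≤ (primorial-2^-≤ j) (product-primesIn-≤ x) ⟩
  2 ^ (2 * x) * 2 ^ (x + x)                          ≡⟨ ^-distribˡ-+-* 2 (2 * x) (x + x) ⟨
  2 ^ (2 * x + (x + x))                              ≡⟨ cong (2 ^_) (ring x) ⟩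
  2 ^ (2 * (2 * x))                                  ∎
  where
  open ≤-Reasoning
  x = 2 ^ j
  ring : ∀ x → 2 * x + (x + x) ≡ 2 * (2 * x)
  ring = solve-∀

-- Every prime counted exceeds 2^s, so (2^s)^count is at most the primorial of 2^j; compare
-- exponents of 2.
chebyshev-upper : ∀ s j len → 2 ^ s + len ≡ 2 ^ j → s * length (primesIn (2 ^ s) len) ≤ 2 * 2 ^ j
chebyshev-upper s j len eq = ^-cancelʳ-≤ ≤-refl (begin
  2 ^ (s * c)                                                         ≡⟨ ^-*-assoc 2 s c ⟨
  (2 ^ s) ^ c                                                         ≤⟨ ^-length≤product (2 ^ s) large (All.tabulate (<⇒≤ ∘ proj₁ ∘ proj₂ ∘ ∈-primesIn⁻ (2 ^ s) len)) ⟩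
  product large                                                       ≤⟨ m≤n*m (product large) (product small) {{productOfPrimes≢0 (primesIn-prime 0 (2 ^ s))}} ⟩
  product small * product large                                       ≡⟨ trans (cong product (primesIn-++ 0 (2 ^ s) len)) (product-++ small large) ⟨
  product (primesIn 0 (2 ^ s + len))                                  ≡⟨ cong (product ∘ primesIn 0) eq ⟩
  product (primesIn 0 (2 ^ j))                                        ≤⟨ primorial-2^-≤ j ⟩
  2 ^ (2 * 2 ^ j)                                                     ∎)
  where
  open ≤-Reasoning
  small = primesIn 0 (2 ^ s)
  large = primesIn (2 ^ s) len
  c = length large

-- Chebyshev's lower bound via integrals of x^a (1 - x)^b

module _ (L N : ℕ) .{{_ : NonZero L}} (∣L : ∀ m → 1 ≤ m → m ≤ N → m ∣ L) where

  -- g = L ∫₀¹ xᵃ (1 - x)ᵇ dx = L a! b! / (a + b + 1)!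
  Beta : ℕ → ℕ → ℕ → Set
  Beta a b g = g * (suc (a + b)) ! ≡ L * (a ! * b !)

  -- Integrality of the integral times `L`. For a = 0 it is L / (b + 1), and `b + 1` divides `L`;
  -- the step uses x^(a+1) (1 - x)^b = x^a (1 - x)^b - x^a (1 - x)^(b+1).
  beta-exists : ∀ a b → a + b < N → ∃[ g ] Beta a b g
  beta-exists zero b b<N with ∣L (suc b) (s≤s z≤n) b<N
  ... | divides g eq = g , trans (sym (*-assoc g (suc b) (b !))) (trans (cong (_* b !) (sym eq)) (cong (L *_) (sym (*-identityˡ (b !)))))
  beta-exists (suc a) b 1+a+b<N
    with beta-exists a b (<-trans (n<1+n (a + b)) 1+a+b<N)
       | beta-exists a (suc b) (subst (_< N) (sym (+-suc a b)) 1+a+b<N)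
  ... | g , eq | h , eq′ = g ∸ h , (begin
    (g ∸ h) * F                                                  ≡⟨ *-distribʳ-∸ F g h ⟩
    g * F ∸ h * F                                                ≡⟨ cong₂ _∸_ gF hF ⟩
    (suc a + suc b) * (L * (a ! * b !)) ∸ suc b * (L * (a ! * b !))    ≡⟨ *-distribʳ-∸ (L * (a ! * b !)) (suc a + suc b) (suc b) ⟨
    (suc a + suc b ∸ suc b) * (L * (a ! * b !))                  ≡⟨ cong (_* (L * (a ! * b !))) (m+n∸n≡m (suc a) (suc b)) ⟩
    suc a * (L * (a ! * b !))                                    ≡⟨ out (suc a) L (a !) (b !) ⟩
    L * (suc a ! * b !)                                          ∎)
    where
    open ≡-Reasoning
    F = (suc (suc a + b)) !
    out : ∀ c L x y → c * (L * (x * y)) ≡ L * (c * x * y)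
    out = solve-∀
    shift : ∀ g c f → g * (c * f) ≡ c * (g * f)
    shift = solve-∀
    gF : g * F ≡ (suc a + suc b) * (L * (a ! * b !))
    gF = trans (shift g (suc (suc (a + b))) ((suc (a + b)) !)) (cong₂ _*_ (cong suc (sym (+-suc a b))) eq)
    hF : h * F ≡ suc b * (L * (a ! * b !))
    hF = begin
      h * F                                   ≡⟨ cong (λ z → h * (suc z) !) (+-suc a b) ⟨
      h * (suc (a + suc b)) !                 ≡⟨ eq′ ⟩
      L * (a ! * (suc b * b !))               ≡⟨ in′ (suc b) L (a !) (b !) ⟩
      suc b * (L * (a ! * b !))               ∎
      where
      in′ : ∀ c L x y → L * (x * (c * y)) ≡ c * (L * (x * y))
      in′ = solve-∀

  -- This is x + (1 - x) = 1 under the integral sign.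
  beta-Pascal : ∀ {a b g g₁ g₂} → Beta a b g → Beta (suc a) b g₁ → Beta a (suc b) g₂ → g ≡ g₁ + g₂
  beta-Pascal {a} {b} {g} {g₁} {g₂} eq eq₁ eq₂ = *-cancelʳ-≡ g (g₁ + g₂) ((suc (suc (a + b))) !) {{(suc (suc (a + b))) !≢0}} (begin
    g * (suc (suc (a + b))) !                                       ≡⟨ shift g (suc (suc (a + b))) _ ⟩
    suc (suc (a + b)) * (g * (suc (a + b)) !)                       ≡⟨ cong (suc (suc (a + b)) *_) eq ⟩
    suc (suc (a + b)) * (L * (a ! * b !))                           ≡⟨ ring a b L (a !) (b !) ⟩
    L * (suc a * a ! * b !) + L * (a ! * (suc b * b !))             ≡⟨ cong₂ _+_ eq₁ eq₂ ⟨
    g₁ * (suc (suc (a + b))) ! + g₂ * (suc (a + suc b)) !           ≡⟨ cong (λ z → g₁ * (suc (suc (a + b))) ! + g₂ * (suc z) !) (+-suc a b) ⟩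
    g₁ * (suc (suc (a + b))) ! + g₂ * (suc (suc (a + b))) !         ≡⟨ *-distribʳ-+ _ g₁ g₂ ⟨
    (g₁ + g₂) * (suc (suc (a + b))) !                               ∎)
    where
    open ≡-Reasoning
    shift : ∀ g c f → g * (c * f) ≡ c * (g * f)
    shift = solve-∀
    ring : ∀ a b L x y → suc (suc (a + b)) * (L * (x * y)) ≡ L * (suc a * x * y) + L * (x * (suc b * y))
    ring = solve-∀

  -- Splitting `t` times by `beta-Pascal` writes `g` as a sum of 2^t such integrals; each is a
  -- positive integer, hence at least 1.
  beta-lower : ∀ t a b {g} → a + b + t < N → Beta a b g → 2 ^ t ≤ g
  beta-lower zero a b {zero} _ eq = contradiction (sym eq) (≢-nonZero⁻¹ (L * (a ! * b !)) {{m*n≢0 L (a ! * b !)}})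
    where instance _ = a !* b !≢0
  beta-lower zero a b {suc g} _ eq = s≤s z≤n
  beta-lower (suc t) a b {g} lt eq
    with beta-exists (suc a) b (≤-<-trans (≤-trans (m≤m+n _ t) (≤-reflexive (sym (+-suc (a + b) t)))) lt)
       | beta-exists a (suc b) (≤-<-trans (≤-trans (m≤m+n _ t) (≤-reflexive (trans (cong (_+ t) (+-suc a b)) (sym (+-suc (a + b) t))))) lt)
  ... | g₁ , eq₁ | g₂ , eq₂ = begin
    2 ^ suc t            ≡⟨ cong (2 ^ t +_) (+-identityʳ _) ⟩
    2 ^ t + 2 ^ t        ≤⟨ +-mono-≤ (beta-lower t (suc a) b {g₁} (subst (_< N) (+-suc (a + b) t) lt) eq₁)
                                     (beta-lower t a (suc b) {g₂} (subst (_< N) (trans (+-suc (a + b) t) (cong (_+ t) (sym (+-suc a b)))) lt) eq₂) ⟩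
    g₁ + g₂              ≡⟨ beta-Pascal {a} {b} {g} {g₁} {g₂} eq eq₁ eq₂ ⟨
    g                    ∎
    where open ≤-Reasoning

  common-multiple-lower : ∀ {n} → n < N → 2 ^ n ≤ L
  -- For a = b = 0 the integrand is 1 and the value is `L` itself.
  common-multiple-lower {n} n<N = beta-lower n 0 0 n<N (trans (*-identityʳ L) (sym (*-identityʳ L)))

-- The largest e with p ^ e ≤ N, for p ≥ 2 and N ≥ 1.
floorLog : ℕ → ℕ → ℕ
floorLog p N = ∑ (λ a → ind (p ^ a ≤? N)) N

module _ {p N} (2≤p : 2 ≤ p) (1≤N : 1 ≤ N) where

  private
    anti : ∀ {a b} → a ≤ b → p ^ b ≤ N → p ^ a ≤ N
    anti a≤b = ≤-trans (^-monoʳ-≤ p {{>-nonZero (≤-trans (s≤s z≤n) 2≤p)}} a≤b)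

  ^-floorLog-≤ : p ^ floorLog p N ≤ N
  ^-floorLog-≤ = ∑-antitone⁻ (λ a → p ^ a ≤? N) anti N _ 1≤N ≤-refl

  ≤-floorLog : ∀ {a} → p ^ a ≤ N → a ≤ floorLog p N
  ≤-floorLog {a} le = ∑-antitone⁺ (λ a → p ^ a ≤? N) anti N a (≤-trans (<⇒≤ (n<p^n 2≤p a)) le) le

-- The least common multiple of 1, ..., N + 1 is the product, over the primes up to N + 1, of their
-- largest powers not exceeding N + 1. It is at least 2^N, and each of its factors is at most N + 1.
chebyshev-lower : ∀ N → 2 ^ N ≤ suc N ^ length (primesIn 0 (suc N))
chebyshev-lower N = ≤-trans (common-multiple-lower L (suc N) ∣L (n<1+n N)) L≤
  where
  ps = primesIn 0 (suc N)
  pow : ℕ → ℕ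
  pow p = p ^ floorLog p (suc N)
  L = product (map pow ps)
  instance
    L≢0 : NonZero L
    L≢0 = go ps (primesIn-prime 0 (suc N))
      where
      go : ∀ qs → All Prime qs → NonZero (product (map pow qs))
      go [] [] = _
      go (q ∷ qs) (pq ∷ pqs) = m*n≢0 _ _ {{m^n≢0 q (floorLog q (suc N)) {{prime⇒nonZero pq}}}} {{go qs pqs}}
  L≤ : L ≤ suc N ^ length ps
  L≤ = ≤-trans (product≤^-length (suc N) (map pow ps) (All.map⁺ (All.map (λ pp → ^-floorLog-≤ (prime⇒2≤ pp) (s≤s z≤n)) (primesIn-prime 0 (suc N)))))
               (≤-reflexive (cong (suc N ^_) (length-map pow ps)))
  ∣L : ∀ m → 1 ≤ m → m ≤ suc N → m ∣ L
  ∣L (suc m) _ m≤ = ∣-by-prime-powers (suc m) L λ where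
    p zero    pp d → 1∣ L
    p (suc k) pp d → let p^≤ = ≤-trans (∣⇒≤ d) m≤ in
      ∣-trans (^-mono-∣ p (≤-floorLog (prime⇒2≤ pp) (s≤s z≤n) {suc k} p^≤))
        (∈⇒∣product (∈-map⁺ pow (∈-primesIn⁺ pp (<-trans z<s (prime⇒2≤ pp)) (≤-trans (∣⇒≤ (m*n∣⇒m∣ p (p ^ k) d)) m≤))))

-- Infinitude of primes and a criterion for the limit superior

primes-unbounded : ∀ M → ∃[ p ] (Prime p × M < p)
primes-unbounded M with prime-divisor (suc (M !)) (s≤s (>-nonZero⁻¹ (M !) {{M !≢0}}))
... | p , pp , p∣ = p , pp , ≰⇒> λ p≤M →
  ¬prime[1] (subst Prime (∣1⇒≡1 (∣m+n∣m⇒∣n (subst (p ∣_) (+-comm 1 (M !)) p∣) (≤⇒∣! {{prime⇒nonZero pp}} p≤M))) pp)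

-- The witnesses say f(n)/n ≥ 1 - c/R with c/R < 1/(k + 1), in a form free of division and
-- subtraction.
limsup-criterion : ∀ {f} → (∀ n .{{_ : NonZero n}} → f n ≤ n) →
  (∀ k N → ∃[ n ] (N ≤ n × 1 ≤ n × ∃[ R ] ∃[ c ] (R * n ≤ R * f n + c * n × suc k * c < R))) →
  LimsupRatioIsOne f
limsup-criterion {f} upper lower = (λ k → 1 , above k) , λ k N →
  let (n , N≤n , 1≤n , R , c , bound , small) = lower k N in n , N≤n , 1≤n , below k n R c 1≤n bound small
  where
  above : ∀ k n → 1 ≤ n → suc k * f n < (suc k + 1) * n
  above k n 1≤n = begin-strict
    suc k * f n          ≤⟨ *-monoʳ-≤ (suc k) (upper n {{>-nonZero 1≤n}}) ⟩
    suc k * n            <⟨ m<m+n (suc k * n) 1≤n ⟩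
    suc k * n + n        ≡⟨ cong (suc k * n +_) (*-identityˡ n) ⟨
    suc k * n + 1 * n    ≡⟨ *-distribʳ-+ n (suc k) 1 ⟨
    (suc k + 1) * n      ∎
    where open ≤-Reasoning
  below : ∀ k n R c → 1 ≤ n → R * n ≤ R * f n + c * n → suc k * c < R → k * n < suc k * f n
  below k n R c 1≤n bound small = *-cancelˡ-< R _ _ (+-cancelʳ-< (R * n) _ _ (begin-strict
    R * (k * n) + R * n                        ≡⟨ ring₁ R k n ⟩
    suc k * (R * n)                            ≤⟨ *-monoʳ-≤ (suc k) bound ⟩
    suc k * (R * f n + c * n)                  ≡⟨ ring₂ (suc k) R (f n) c n ⟩
    R * (suc k * f n) + suc k * c * n          <⟨ +-monoʳ-< (R * (suc k * f n)) (*-monoˡ-< n {{>-nonZero 1≤n}} small) ⟩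
    R * (suc k * f n) + R * n                  ∎))
    where
    open ≤-Reasoning
    ring₁ : ∀ R k n → R * (k * n) + R * n ≡ suc k * (R * n)
    ring₁ = solve-∀
    ring₂ : ∀ j R F c n → j * (R * F + c * n) ≡ R * (j * F) + j * c * n
    ring₂ = solve-∀

-- Lower bounds along n = 2^p

unique-constant : ∀ {q : ℕ} {xs} → Unique xs → All (_≡ q) xs → q ∈ xs → xs ≡ q ∷ []
unique-constant {xs = x ∷ []} _ (refl ∷ []) _ = refl
unique-constant {xs = x ∷ y ∷ _} ((x≢y ∷ _) ∷ _) (refl ∷ refl ∷ _) _ = contradiction refl x≢y

-- As `q` is the only prime divisor there is a single part, and `product-unitaryParts` identifies it
-- with the whole of `q ^ a`.
φ*-prime-power : ∀ {q} → Prime q → ∀ a .{{_ : NonZero a}} → φ* (q ^ a) ≡ q ^ a ∸ 1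
φ*-prime-power {q} pq a@(suc a′) = begin
  φ* n                                         ≡⟨ φ*-unitaryParts n ⟩
  product (map (_∸ 1) (unitaryParts n))        ≡⟨ cong (product ∘ map (_∸ 1)) parts ⟩
  (q ^ val q n ∸ 1) * 1                        ≡⟨ *-identityʳ _ ⟩
  q ^ val q n ∸ 1                              ≡⟨ cong (_∸ 1) (trans (sym (*-identityʳ (q ^ val q n))) (trans (cong product (sym parts)) (product-unitaryParts n))) ⟩
  n ∸ 1                                        ∎
  where
  open ≡-Reasoning
  n = q ^ a
  instance _ = m^n≢0 q a {{prime⇒nonZero pq}}
  only-q : ∀ {p} → p ∈ primeDivisors n → p ≡ q
  only-q p∈ = let (pp , p∣) = ∈-primeDivisors⁻ n p∈ in prime∣prime⇒≡ pp pq (prime∣^⇒∣ pp q a p∣)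
  parts : unitaryParts n ≡ q ^ val q n ∷ []
  parts = cong (map (λ p → p ^ val p n))
    (unique-constant (primeDivisors-unique n) (All.tabulate only-q) (∈-primeDivisors⁺ pq (m∣m*n (q ^ a′))))

module _ (F : ℕ → ℕ)
  (F-lower-bound : ∀ {R n} B .{{_ : NonZero n}} → 2 ≤ R → (∀ {p} → Prime p → p ∣ n → R ≤ p) → n ≤ R ^ B → R * n ≤ R * F n + B * n)
  where

  -- `F` stands for `φ` or `φ*`, applied to `φ* n` = 2^p - 1, whose prime factors are all at least
  -- `p`.
  lower-at-2^p : ∀ k N → ∃[ n ] (N ≤ n × 1 ≤ n × ∃[ R ] ∃[ c ] (R * n ≤ R * F (φ* n) + c * n × suc k * c < R))
  -- The three summands ensure `N ≤ n`, then `2 ^ s ≤ p` for `m≤p^B`, then the slack for `small`.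
  lower-at-2^p k N with primes-unbounded (N + (2 ^ (2 * suc k) + 4 * suc k))
  ... | p , pp , p> = n , N≤n , m^n>0 2 p , p , suc B , bound , small
    where
    n = 2 ^ p
    s = 2 * suc k
    B = suc (p / s)
    p<n : p < n
    p<n = n<p^n ≤-refl p
    N≤n : N ≤ n
    N≤n = ≤-trans (m≤m+n N _) (≤-trans (<⇒≤ p>) (<⇒≤ p<n))
    2^s≤p : 2 ^ s ≤ p
    2^s≤p = ≤-trans (≤-trans (m≤m+n _ _) (m≤n+m _ N)) (<⇒≤ p>)
    4[1+k]<p : 4 * suc k < p
    4[1+k]<p = ≤-<-trans (≤-trans (m≤n+m _ (2 ^ s)) (m≤n+m _ N)) p>
    instance
      _ = prime⇒nonZero pp
      m≢0 : NonZero (n ∸ 1)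
      m≢0 = >-nonZero (m<n⇒0<n∸m (≤-<-trans (>-nonZero⁻¹ p) p<n))
    p≤sB : p ≤ s * B
    p≤sB = begin
      p                        ≡⟨ m≡m%n+[m/n]*n p s ⟩
      p % s + p / s * s        ≤⟨ +-monoˡ-≤ (p / s * s) (<⇒≤ (m%n<n p s)) ⟩
      s + p / s * s            ≡⟨ *-comm (suc (p / s)) s ⟩
      s * B                    ∎
      where open ≤-Reasoning
    m≤p^B : n ∸ 1 ≤ p ^ B
    m≤p^B = begin
      n ∸ 1            ≤⟨ m∸n≤m n 1 ⟩
      2 ^ p            ≤⟨ ^-monoʳ-≤ 2 p≤sB ⟩
      2 ^ (s * B)      ≡⟨ ^-*-assoc 2 s B ⟨
      (2 ^ s) ^ B      ≤⟨ ^-monoˡ-≤ B 2^s≤p ⟩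
      p ^ B            ∎
      where open ≤-Reasoning
    -- Passing from `n ∸ 1` to `n` costs `p ≤ n`, which is the extra one in `suc B`.
    bound : p * n ≤ p * F (φ* n) + suc B * n
    bound = begin
      p * n                                        ≡⟨ cong (p *_) (m∸n+n≡m (m^n>0 2 p)) ⟨
      p * (n ∸ 1 + 1)                              ≡⟨ *-distribˡ-+ p (n ∸ 1) 1 ⟩
      p * (n ∸ 1) + p * 1                          ≤⟨ +-mono-≤ (F-lower-bound {p} {n ∸ 1} B (prime⇒2≤ pp) (λ pq q∣ → prime∣2^p∸1⇒p≤ pp pq q∣) m≤p^B)
                                                               (≤-trans (≤-reflexive (*-identityʳ p)) (<⇒≤ p<n)) ⟩
      p * F (n ∸ 1) + B * (n ∸ 1) + n              ≤⟨ +-monoˡ-≤ n (+-monoʳ-≤ (p * F (n ∸ 1)) (*-monoʳ-≤ B (m∸n≤m n 1))) ⟩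
      p * F (n ∸ 1) + B * n + n                    ≡⟨ trans (+-assoc (p * F (n ∸ 1)) (B * n) n) (cong (p * F (n ∸ 1) +_) (+-comm (B * n) n)) ⟩
      p * F (n ∸ 1) + suc B * n                    ≡⟨ cong (λ m → p * F m + suc B * n) (φ*-prime-power prime[2] p) ⟨
      p * F (φ* n) + suc B * n                     ∎
      where open ≤-Reasoning
    -- As `s = 2 * suc k`, twice the left side is `p / s * s + 4 * suc k`, hence less than `2 * p`.
    small : suc k * suc B < p
    small = *-cancelˡ-< 2 _ _ (begin-strict
      2 * (suc k * suc B)                ≡⟨ ring (suc k) (p / s) ⟩
      p / s * s + 4 * suc k              <⟨ +-mono-≤-< (m/n*n≤m p s) 4[1+k]<p ⟩
      p + p                              ≡⟨ cong (p +_) (+-identityʳ p) ⟨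
      2 * p                              ∎)
      where
      open ≤-Reasoning
      ring : ∀ j x → 2 * (j * suc (suc x)) ≡ x * (2 * j) + 4 * j
      ring = solve-∀

-- Products of pruned primes, for the lower bound on φ* ∘ φ

s²+s≤2^s : ∀ s → 5 ≤ s → s * s + s ≤ 2 ^ s
s²+s≤2^s s 5≤s = subst (λ s → s * s + s ≤ 2 ^ s) (m+[n∸m]≡n 5≤s) (go (s ∸ 5))
  where
  go : ∀ t → (5 + t) * (5 + t) + (5 + t) ≤ 2 ^ (5 + t)
  -- The induction starts at 5 because the inequality fails at 4, where it reads 20 ≤ 16.
  go zero    = ≤ᵇ⇒≤ 30 32 _
  go (suc t) = begin
    (5 + suc t) * (5 + suc t) + (5 + suc t)                          ≤⟨ m≤m+n _ (18 + 9 * t + t * t) ⟩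
    (5 + suc t) * (5 + suc t) + (5 + suc t) + (18 + 9 * t + t * t)   ≡⟨ ring t ⟩
    2 * ((5 + t) * (5 + t) + (5 + t))                                ≤⟨ *-monoʳ-≤ 2 (go t) ⟩
    2 * 2 ^ (5 + t)                                                  ∎
    where
    open ≤-Reasoning
    ring : ∀ t → (5 + suc t) * (5 + suc t) + (5 + suc t) + (18 + 9 * t + t * t) ≡ 2 * ((5 + t) * (5 + t) + (5 + t))
    ring = solve-∀

sum-map-≤ : ∀ (w : ℕ → ℕ) c xs → All (λ x → w x ≤ c) xs → sum (map w xs) ≤ length xs * c
sum-map-≤ w c [] [] = z≤n
sum-map-≤ w c (x ∷ xs) (wx≤ ∷ ws≤) = +-mono-≤ wx≤ (sum-map-≤ w c xs ws≤)

^-count-∣ : ∀ r ps → r ^ length (filter (λ p → r ∣? (p ∸ 1)) ps) ∣ product (map (_∸ 1) ps)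
^-count-∣ r [] = 1∣ 1
^-count-∣ r (p ∷ ps) with r ∣? (p ∸ 1)
... | yes r∣ = *-pres-∣ r∣ (^-count-∣ r ps)
... | no _   = ∣n⇒∣m*n (p ∸ 1) (^-count-∣ r ps)

module Construction (s : ℕ) (5≤s : 5 ≤ s) where

  X R : ℕ
  X = 2 ^ s
  R = X * X

  X≤R : X ≤ R
  X≤R = m≤m*n X X {{m^n≢0 2 s}}

  R≡2^2s : R ≡ 2 ^ (s + s)
  R≡2^2s = sym (^-distribˡ-+-* 2 s s)

  -- `T` exceeds the total `weight` of the primes up to `R`: at most `X` primes r ≤ X cost `2 * s`
  -- each, and the `c` primes in (X, R] cost 1 each.
  c T : ℕ
  c = length (primesIn X (R ∸ X))
  T = suc (X * (2 * s) + c * 1)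

  -- This is T = O(R / s). Chebyshev bounds `s * c` by `2 * R`, and the contribution of the small
  -- primes is at most `2 * R` because s² + s ≤ X.
  s*T≤4R : s * T ≤ 4 * R
  s*T≤4R = begin
    s * suc (X * (2 * s) + c * 1)                   ≡⟨ ring₁ s X c ⟩
    s * c + (2 * (s * s) * X + s)                   ≤⟨ +-mono-≤ (chebyshev-upper s (s + s) (R ∸ X) (trans (m+[n∸m]≡n X≤R) R≡2^2s))
                                                                (+-monoʳ-≤ (2 * (s * s) * X) (≤-trans (m≤m*n s X {{m^n≢0 2 s}}) (m≤m+n (s * X) (s * X)))) ⟩
    2 * 2 ^ (s + s) + (2 * (s * s) * X + (s * X + s * X))  ≡⟨ cong₂ _+_ (cong (2 *_) (sym R≡2^2s)) (ring₂ s X) ⟩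
    2 * R + 2 * ((s * s + s) * X)                   ≤⟨ +-monoʳ-≤ (2 * R) (*-monoʳ-≤ 2 (*-monoˡ-≤ X (s²+s≤2^s s 5≤s))) ⟩
    2 * R + 2 * R                                   ≡⟨ *-distribʳ-+ R 2 2 ⟨
    4 * R                                           ∎
    where
    open ≤-Reasoning
    ring₁ : ∀ s X c → s * suc (X * (2 * s) + c * 1) ≡ s * c + (2 * (s * s) * X + s)
    ring₁ = solve-∀
    ring₂ : ∀ s X → 2 * (s * s) * X + (s * X + s * X) ≡ 2 * ((s * s + s) * X)
    ring₂ = solve-∀

  -- With fewer than `T ≤ R` primes in (R, R²] there would be at most 2R primes up to R² = 2^(4s).
  -- Then `chebyshev-lower` gives R² - 1 ≤ 4s · 2R, against 8s + 2 ≤ R.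
  many-primes : T ≤ R → T ≤ length (primesIn R (R * R ∸ R))
  many-primes T≤R with T ≤? length (primesIn R (R * R ∸ R))
  ... | yes le = le
  ... | no few = contradiction R²≤ (<⇒≱ R²>)
    where
    open ≤-Reasoning
    l = length (primesIn R (R * R ∸ R))
    instance
      _ = m^n≢0 2 s
      X²≢0 : NonZero R
      X²≢0 = m*n≢0 X X
      X⁴≢0 : NonZero (R * R)
      X⁴≢0 = m*n≢0 R R
    π = length (primesIn 0 (R * R))
    R²≡2^4s : R * R ≡ 2 ^ (4 * s)
    R²≡2^4s = trans (cong₂ _*_ R≡2^2s R≡2^2s) (trans (sym (^-distribˡ-+-* 2 (s + s) (s + s))) (cong (2 ^_) (ring s)))
      where
      ring : ∀ s → s + s + (s + s) ≡ 4 * s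
      ring = solve-∀
    π≤2R : π ≤ 2 * R
    π≤2R = begin
      length (primesIn 0 (R * R))                ≡⟨ cong (length ∘ primesIn 0) (m+[n∸m]≡n (m≤m*n R R)) ⟨
      length (primesIn 0 (R + (R * R ∸ R)))      ≡⟨ trans (cong length (primesIn-++ 0 R (R * R ∸ R))) (length-++ (primesIn 0 R)) ⟩
      length (primesIn 0 R) + l                  ≤⟨ +-mono-≤ (length-primesIn 0 R) (<⇒≤ (<-≤-trans (≰⇒> few) T≤R)) ⟩
      R + R                                      ≡⟨ cong (R +_) (+-identityʳ R) ⟨
      2 * R                                      ∎
    R²∸1≤ : R * R ∸ 1 ≤ 4 * s * π
    R²∸1≤ = ^-cancelʳ-≤ ≤-refl (begin
      2 ^ (R * R ∸ 1)                            ≤⟨ chebyshev-lower (R * R ∸ 1) ⟩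
      suc (R * R ∸ 1) ^ length (primesIn 0 (suc (R * R ∸ 1)))      ≡⟨ cong (λ z → z ^ length (primesIn 0 z)) (suc-pred (R * R)) ⟩
      (R * R) ^ π                                ≡⟨ cong (_^ π) R²≡2^4s ⟩
      (2 ^ (4 * s)) ^ π                          ≡⟨ ^-*-assoc 2 (4 * s) π ⟩
      2 ^ (4 * s * π)                            ∎)
    R²≤ : R * R ≤ suc (8 * s * R)
    R²≤ = begin
      R * R                        ≡⟨ suc-pred (R * R) ⟨
      suc (R * R ∸ 1)              ≤⟨ s≤s (≤-trans R²∸1≤ (*-monoʳ-≤ (4 * s) π≤2R)) ⟩
      suc (4 * s * (2 * R))        ≡⟨ cong suc (ring s R) ⟩
      suc (8 * s * R)              ∎
      where
      ring : ∀ s R → 4 * s * (2 * R) ≡ 8 * s * R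
      ring = solve-∀
    8≤X : 8 ≤ X
    8≤X = ^-monoʳ-≤ 2 {3} {s} (≤-trans (≤ᵇ⇒≤ 3 5 _) 5≤s)
    8s+2≤R : 8 * s + 2 ≤ R
    8s+2≤R = begin
      8 * s + 2            ≤⟨ +-monoʳ-≤ (8 * s) (≤ᵇ⇒≤ 2 8 _) ⟩
      8 * s + 8            ≡⟨ trans (+-comm (8 * s) 8) (sym (*-suc 8 s)) ⟩
      8 * suc s            ≤⟨ *-mono-≤ 8≤X (n<p^n ≤-refl s) ⟩
      X * X                ∎
    R²> : suc (8 * s * R) < R * R
    R²> = begin-strict
      suc (8 * s * R)              <⟨ s≤s (≤-reflexive (+-comm 1 _)) ⟩
      suc (8 * s * R + 1)          ≡⟨ sym (+-suc (8 * s * R) 1) ⟩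
      8 * s * R + 2 * 1            ≤⟨ +-monoʳ-≤ (8 * s * R) (*-monoʳ-≤ 2 (>-nonZero⁻¹ R)) ⟩
      8 * s * R + 2 * R            ≡⟨ *-distribʳ-+ R (8 * s) 2 ⟨
      (8 * s + 2) * R              ≤⟨ *-monoˡ-≤ R 8s+2≤R ⟩
      R * R                        ∎

  -- Chosen so that `suc (weight r)` factors `r` reach `R`: for r ≤ X because r ≥ 2 and R = 2^(2s),
  -- for r > X because r² > X² = R.
  weight : ℕ → ℕ
  weight r with r ≤? X
  ... | yes _ = 2 * s
  ... | no _  = 1

  weight-≤2s : ∀ r → weight r ≤ 2 * s
  weight-≤2s r with r ≤? X
  ... | yes _ = ≤-refl
  ... | no _  = ≤-trans (≤-trans (s≤s z≤n) 5≤s) (m≤m+n s _)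

  weight-large : ∀ {r} → X < r → weight r ≤ 1
  weight-large {r} X<r with r ≤? X
  ... | yes r≤X = contradiction r≤X (<⇒≱ X<r)
  ... | no _    = ≤-refl

  R≤^weight : ∀ {r} → Prime r → R ≤ r ^ suc (weight r)
  R≤^weight {r} pr with r ≤? X
  ... | yes _ = begin
    R                      ≡⟨ R≡2^2s ⟩
    2 ^ (s + s)            ≤⟨ ^-monoʳ-≤ 2 (≤-trans (≤-reflexive (cong (s +_) (sym (+-identityʳ s)))) (n≤1+n (2 * s))) ⟩
    2 ^ suc (2 * s)        ≤⟨ ^-monoˡ-≤ (suc (2 * s)) (prime⇒2≤ pr) ⟩
    r ^ suc (2 * s)        ∎
    where open ≤-Reasoning
  ... | no r≰X = *-mono-≤ (<⇒≤ (≰⇒> r≰X)) (≤-trans (<⇒≤ (≰⇒> r≰X)) (≤-reflexive (sym (*-identityʳ r))))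

  sum-weight< : sum (map weight (primesIn 0 R)) < T
  sum-weight< = s≤s (begin
    sum (map weight (primesIn 0 R))                                ≡⟨ cong (sum ∘ map weight ∘ primesIn 0) (m+[n∸m]≡n X≤R) ⟨
    sum (map weight (primesIn 0 (X + (R ∸ X))))                    ≡⟨ cong (sum ∘ map weight) (primesIn-++ 0 X (R ∸ X)) ⟩
    sum (map weight (primesIn 0 X ++ primesIn X (R ∸ X)))          ≡⟨ trans (cong sum (map-++ weight (primesIn 0 X) _)) (sum-++ (map weight (primesIn 0 X)) _) ⟩
    sum (map weight (primesIn 0 X)) + sum (map weight (primesIn X (R ∸ X)))
      ≤⟨ +-mono-≤ (≤-trans (sum-map-≤ weight (2 * s) (primesIn 0 X) (All.tabulate λ {r} _ → weight-≤2s r)) (*-monoˡ-≤ (2 * s) (length-primesIn 0 X)))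
                  (sum-map-≤ weight 1 (primesIn X (R ∸ X)) (All.tabulate λ r∈ → weight-large (proj₁ (proj₂ (∈-primesIn⁻ X (R ∸ X) r∈))))) ⟩
    X * (2 * s) + c * 1                                            ∎)
    where open ≤-Reasoning

  -- Two losses add up to `3 * T`: at most `T` from `n` to `φ n`, as `n` has at most `T` prime
  -- factors, all above `R`, and `2 * T` from `φ n` to `φ* (φ n)`, as `φ n ≤ R ^ (2 * T)`.
  product-pruned : T ≤ R → ∃[ n ] (R ≤ n × R * n ≤ R * φ* (φ n) + 3 * T * n)
  -- Exactly `T` primes are taken: enough to pay for the pruning, few enough to bound the size of
  -- `φ n`.
  product-pruned T≤R with prune (λ r p → r ∣? (p ∸ 1)) weight (primesIn 0 R) (take T (primesIn R (R * R ∸ R)))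
      (Unique.take⁺ T (primesIn-unique R (R * R ∸ R)))
      (<-≤-trans sum-weight< (≤-reflexive (sym (trans (length-take T (primesIn R (R * R ∸ R))) (m≤n⇒m⊓n≡m (many-primes T≤R))))))
  ... | S , uS , S⊆ , len≤ , nonempty , pruned = n , R≤n , bound
    where
    instance
      _ = m^n≢0 2 s
      R≢0 : NonZero R
      R≢0 = m*n≢0 X X
    S-spec : ∀ {p} → p ∈ S → Prime p × R < p × p ≤ R * R
    S-spec p∈ with ∈-primesIn⁻ R (R * R ∸ R) (∈-take⇒∈ T (S⊆ p∈))
      where
      ∈-take⇒∈ : ∀ t {x : ℕ} {xs} → x ∈ take t xs → x ∈ xs
      ∈-take⇒∈ (suc t) {xs = _ ∷ _} (here eq) = here eq
      ∈-take⇒∈ (suc t) {xs = _ ∷ _} (there x∈) = there (∈-take⇒∈ t x∈)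
    ... | pp , R<p , p≤ = pp , R<p , ≤-trans p≤ (≤-reflexive (m+[n∸m]≡n (m≤m*n R R)))
    S-prime : All Prime S
    S-prime = All.tabulate (proj₁ ∘ S-spec)
    S-large : All (R ≤_) S
    S-large = All.tabulate (<⇒≤ ∘ proj₁ ∘ proj₂ ∘ S-spec)
    len≤T : length S ≤ T
    len≤T = ≤-trans len≤ (≤-trans (≤-reflexive (length-take T (primesIn R (R * R ∸ R)))) (m⊓n≤m T _))
    n m : ℕ
    n = product S
    m = product (map (_∸ 1) S)
    instance
      n≢0 : NonZero n
      n≢0 = productOfPrimes≢0 S-prime
      m≢0 : NonZero m
      m≢0 = product≢0 (All.map⁺ (All.map (λ pp → >-nonZero (m<n⇒0<n∸m (prime⇒2≤ pp))) S-prime))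
    φn≡m : φ n ≡ m
    φn≡m = φ-product-primes S uS S-prime
    2≤R : 2 ≤ R
    2≤R = ≤-trans (^-monoʳ-≤ 2 {1} (≤-trans (s≤s z≤n) 5≤s)) X≤R
    R≤n : R ≤ n
    R≤n = begin
      R                    ≡⟨ *-identityʳ R ⟨
      R ^ 1                ≤⟨ ^-monoʳ-≤ R nonempty ⟩
      R ^ length S         ≤⟨ ^-length≤product R S S-large ⟩
      n                    ∎
      where open ≤-Reasoning
    m≤R^2T : m ≤ R ^ (2 * T)
    m≤R^2T = begin
      m                        ≤⟨ product-pred-≤ S ⟩
      n                        ≤⟨ product≤^-length (R * R) S (All.tabulate (proj₂ ∘ proj₂ ∘ S-spec)) ⟩
      (R * R) ^ length S       ≤⟨ ^-monoʳ-≤ (R * R) {{m*n≢0 R R}} len≤T ⟩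
      (R * R) ^ T              ≡⟨ cong (_^ T) (cong (R *_) (sym (*-identityʳ R))) ⟩
      (R ^ 2) ^ T              ≡⟨ ^-*-assoc R 2 T ⟩
      R ^ (2 * T)              ∎
      where open ≤-Reasoning
    -- For r > R the first power suffices. Otherwise `r` divides p - 1 for some p in `S`, so pruning
    -- has left more than `weight r` such p, and each contributes a factor `r` to `m`.
    parts-large : ∀ {r} → Prime r → r ∣ m → R ≤ r ^ val r m
    parts-large {r} pr r∣m with r ≤? R
    ... | no r≰R = ≤-trans (<⇒≤ (≰⇒> r≰R)) (p≤p^val (prime⇒2≤ pr) r∣m)
    ... | yes r≤R with prime∣product⇒∃ pr (map (_∸ 1) S) r∣m
    ...   | _ , d∈ , r∣d with ∈-map⁻ (_∸ 1) d∈
    ...     | p , p∈ , refl with pruned (∈-primesIn⁺ {lo = 0} {len = R} pr (<-trans z<s (prime⇒2≤ pr)) r≤R)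
    ...       | inj₁ none = contradiction (subst (p ∈_) none (∈-filter⁺ (λ p → r ∣? (p ∸ 1)) p∈ r∣d)) λ ()
    ...       | inj₂ many = ≤-trans (R≤^weight pr) (^-monoʳ-≤ r {{prime⇒nonZero pr}}
                  (≤-trans many (∣⇒≤val (prime⇒2≤ pr) (^-count-∣ r S))))
    bound : R * n ≤ R * φ* (φ n) + 3 * T * n
    bound = begin
      R * n                                    ≤⟨ product-pred-≥ R S S-large ⟩
      R * m + length S * n                     ≤⟨ +-mono-≤ (φ*-lower-bound (2 * T) 2≤R parts-large m≤R^2T) (*-monoˡ-≤ n len≤T) ⟩
      R * φ* m + 2 * T * m + T * n             ≤⟨ +-monoˡ-≤ (T * n) (+-monoʳ-≤ (R * φ* m) (*-monoʳ-≤ (2 * T) (product-pred-≤ S))) ⟩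
      R * φ* m + 2 * T * n + T * n             ≡⟨ ring (R * φ* m) T n ⟩
      R * φ* m + 3 * T * n                     ≡⟨ cong (λ z → R * φ* z + 3 * T * n) φn≡m ⟨
      R * φ* (φ n) + 3 * T * n                 ∎
      where
      open ≤-Reasoning
      ring : ∀ a T n → a + 2 * T * n + T * n ≡ a + 3 * T * n
      ring = solve-∀

φ*∘φ-lower : ∀ k N → ∃[ n ] (N ≤ n × 1 ≤ n × ∃[ R ] ∃[ c ] (R * n ≤ R * φ* (φ n) + c * n × suc k * c < R))
φ*∘φ-lower k N = let (n , R≤n , bound) = product-pruned T≤R in
  n , ≤-trans N≤R R≤n , ≤-trans (≤-trans (s≤s z≤n) 3jT<R) R≤n , R , 3 * T , bound , 3jT<R
  where
  -- The factor 12 is 4 from `s*T≤4R` times 3 from the loss `3 * T`; `suc N` makes the inequality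
  -- strict and `R` at least `N`.
  s = 12 * (suc k + suc N)
  12≤s : 12 ≤ s
  12≤s = *-monoʳ-≤ 12 (s≤s z≤n)
  open Construction s (≤-trans (≤ᵇ⇒≤ 5 12 _) 12≤s)
  N≤R : N ≤ R
  N≤R = ≤-trans (≤-trans (≤-trans (≤-trans (n≤1+n N) (m≤n+m (suc N) (suc k))) (m≤n*m (suc k + suc N) 12)) (<⇒≤ (n<p^n ≤-refl s))) X≤R
  3jT<R : suc k * (3 * T) < R
  3jT<R = *-cancelˡ-< 4 _ _ (begin-strict
    4 * (suc k * (3 * T))         ≡⟨ ring (suc k) T ⟩
    12 * suc k * T                <⟨ *-monoˡ-< T (*-monoʳ-< 12 (m<m+n (suc k) z<s)) ⟩
    s * T                         ≤⟨ s*T≤4R ⟩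
    4 * R                         ∎)
    where
    open ≤-Reasoning
    ring : ∀ j T → 4 * (j * (3 * T)) ≡ 12 * j * T
    ring = solve-∀
  T≤R : T ≤ R
  T≤R = ≤-trans (m≤n*m T 3) (≤-trans (m≤n*m (3 * T) (suc k)) (<⇒≤ 3jT<R))

-- Upper bound for φ* ∘ φ and conclusion

φ*∘φ≤ : ∀ n .{{_ : NonZero n}} → φ* (φ n) ≤ n
φ*∘φ≤ n with φ n in eq
-- `φ* 0` is an empty product, so the goal is 1 ≤ n.
... | zero  = >-nonZero⁻¹ n
... | suc m = ≤-trans (φ*≤ (suc m)) (subst (_≤ n) eq (φ≤ n))

theorem6 : LimsupRatioIsOne (φ ∘ φ*) × LimsupRatioIsOne (φ* ∘ φ) × LimsupRatioIsOne (φ* ∘ φ*)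
theorem6 =
    limsup-criterion (λ n → ≤-trans (φ≤ (φ* n)) (φ*≤ n)) (lower-at-2^p φ φ-lower-bound)
  , limsup-criterion φ*∘φ≤ φ*∘φ-lower
  , limsup-criterion (λ n → ≤-trans (φ*≤ (φ* n) {{>-nonZero (φ*>0 n)}}) (φ*≤ n)) (lower-at-2^p φ* φ*-lower-bound′)
  where
  φ*-lower-bound′ : ∀ {R n} B .{{_ : NonZero n}} → 2 ≤ R → (∀ {p} → Prime p → p ∣ n → R ≤ p) → n ≤ R ^ B → R * n ≤ R * φ* n + B * n
  φ*-lower-bound′ B 2≤R R≤ = φ*-lower-bound B 2≤R λ pp p∣n → ≤-trans (R≤ pp p∣n) (p≤p^val (prime⇒2≤ pp) p∣n)
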